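{- Let $\mathcal{V}$ be a variety of double-Heyting algebras that is closed under canonical extensions. If $\mathcal{V}$ is coherent, then $\mathcal{V}$ is a discriminator variety.
   Context: A double-Heyting algebra is an algebra $\langle A,\wedge,\vee,\to,-,0,1\rangle$ such that $\langle A,\wedge,\vee,\to,0,1\rangle$ is a Heyting algebra and $\langle A,\vee,\wedge,-,0,1\rangle$ is a dual Heyting algebra, with $-$ dually residuating $\vee$: $x-y\le z\iff x\le y\vee z$. Canonical extensions. A completion of a poset $P$ is a complete lattice $C$ with an order embedding of $P$ into $C$ preserving all existing finite meets and joins; $P$ is identified with its image. An element of $C$ is open (resp. closed) if it is a join (resp. meet) in $C$ of a nonempty subset of $P$; $O$ and $K$ denote the sets of open and closed elements. The completion is dense if every element of $C$ is both a join of closed elements and a meet of open elements; it is compact if for all nonempty $A\subseteq K$, $B\subseteq O$: $\bigwedge A\le\bigvee B$ iff $\bigwedge A_0\le\bigvee B_0$ for some finite nonempty $A_0\subseteq A$, $B_0\subseteq B$. A dense compact completion is called the canonical extension $P^\sigma$ of $P$ (unique up to isomorphism fixing $P$). For $f\colon P^n\to P$, the maps $f^\sigma,f^\pi\colon(P^\sigma)^n\to P^\sigma$ are $$f^\sigma(x)=\bigvee\bigl\{\bigwedge\{f(a)\mid a\in P^n,\ p\le a\le q\}\mid p\in K^n,\ q\in O^n,\ p\le x\le q\bigr\},$$ $$f^\pi(x)=\bigwedge\bigl\{\bigvee\{f(a)\mid a\in P^n,\ p\le a\le q\}\mid p\in K^n,\ q\in O^n,\ p\le x\le q\bigr\}.$$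 The canonical extension of a double-Heyting algebra $\mathbf{A}$ is $\mathbf{A}^\sigma=\langle A^\sigma,\wedge^\sigma,\vee^\sigma,\to^\pi,-^\sigma,0,1\rangle$. $\mathcal{V}$ is closed under canonical extensions if $\mathbf{A}\in\mathcal{V}$ implies $\mathbf{A}^\sigma\in\mathcal{V}$. $\mathcal{V}$ is coherent if every finitely generated subalgebra of a finitely presented member of $\mathcal{V}$ is finitely presented (finitely presented: isomorphic to a quotient of a finitely generated free algebra of $\mathcal{V}$ by a finitely generated congruence). A variety is a discriminator variety if it is generated by a class of algebras on all of which a single term $d(x,y,z)$ is the discriminator: $d(a,a,c)=c$ and $d(a,b,c)=a$ if $a\ne b$. -}

module Defs where

open import Level using (Level; 0ℓ; Lift) renaming (suc to lsuc)
open import Data.Nat using (ℕ)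
open import Data.Fin using (Fin; zero; suc)
open import Data.Product using (Σ; ∃; ∃₂; _×_; _,_; proj₁; proj₂)
open import Data.List using (List; map)
open import Data.List.NonEmpty using (List⁺; toList)
open import Data.List.Membership.Propositional using (_∈_)
open import Data.List.Relation.Unary.All using (All)
open import Data.Vec.Functional using (Vector; []; _∷_)
open import Function using (_⇔_; _on_)
open import Function.Definitions using (Congruent; Bijective)
open import Algebra.Core using (Op₂)
open import Algebra.Definitions using (Congruent₂)
open import Relation.Nullary using (¬_)
open import Relation.Unary using (Pred; Satisfiable; _⊆_; _≐_)
open import Relation.Binary using (Rel; IsEquivalence; Poset)
open import Relation.Binary.PropositionalEquality using (_≡_; cong₂; isEquivalence)
open import Relation.Binary.Morphism.Structures using (IsOrderMonomorphism)
open import Relation.Binary.Lattice.Structures using (IsHeytingAlgebra)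
import Relation.Binary.Construct.On as On

-- `Set` plays the role of the universe of sets; a subset of a complete lattice
-- is a predicate in `Set₁`, because openness and closedness quantify over
-- subsets of a poset.  With excluded middle this size distinction disappears.

1ℓ : Level
1ℓ = lsuc 0ℓ

------------------------------------------------------------------------
-- Algebras in the signature of double-Heyting algebras

data BinOp : Set where
  meet join imp sub : BinOp

record Algebra : Set₁ where
  field
    Carrier       : Set
    _≈_           : Rel Carrier 0ℓ
    ≈-equivalence : IsEquivalence _≈_
    op            : BinOp → Op₂ Carrier
    op-cong       : ∀ o → Congruent₂ _≈_ (op o)
    ⊥ ⊤           : Carrier

  infix  4 _≈_ _≤_
  infixr 7 _∧_
  infixr 6 _∨_
  infixr 5 _⇨_
  infixl 6 _-_

  _∧_ _∨_ _⇨_ _-_ : Op₂ Carrier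
  _∧_ = op meet
  _∨_ = op join
  _⇨_ = op imp
  _-_ = op sub

  _≤_ : Rel Carrier 0ℓ
  x ≤ y = x ∧ y ≈ x

open Algebra using () renaming (Carrier to ∣_∣)

record IsDoubleHeyting (A : Algebra) : Set where
  open Algebra A
  field
    isHeytingAlgebra : IsHeytingAlgebra _≈_ _≤_ _∨_ _∧_ _⇨_ ⊤ ⊥
    dualExponential  : ∀ x y z → (x - y ≤ z) ⇔ (x ≤ y ∨ z)

  poset : Poset 0ℓ 0ℓ 0ℓ
  poset = record
    { isPartialOrder = IsHeytingAlgebra.isPartialOrder isHeytingAlgebra }

record IsHomomorphism (A B : Algebra) (h : ∣ A ∣ → ∣ B ∣) : Set where
  private
    module A = Algebra A
    module B = Algebra B
  field
    ≈-cong : Congruent A._≈_ B._≈_ h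
    ⊥-homo : h A.⊥ B.≈ B.⊥
    ⊤-homo : h A.⊤ B.≈ B.⊤
    homo   : ∀ o x y → h (A.op o x y) B.≈ B.op o (h x) (h y)

infix 4 _≅_

_≅_ : Rel Algebra 0ℓ
A ≅ B = ∃ λ h → IsHomomorphism A B h × Bijective (Algebra._≈_ A) (Algebra._≈_ B) h

------------------------------------------------------------------------
-- Congruences and quotients

module _ (A : Algebra) where
  open Algebra A

  data Cg (R : Rel ∣ A ∣ 0ℓ) : Rel ∣ A ∣ 0ℓ where
    base     : ∀ {x y} → R x y → Cg R x y
    ≈⇒Cg     : ∀ {x y} → x ≈ y → Cg R x y
    Cg-sym   : ∀ {x y} → Cg R x y → Cg R y x
    Cg-trans : ∀ {x y z} → Cg R x y → Cg R y z → Cg R x z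
    Cg-cong  : ∀ o → Congruent₂ (Cg R) (op o)

  infix 8 _/Cg_

  _/Cg_ : Rel ∣ A ∣ 0ℓ → Algebra
  _/Cg_ R = record
    { Carrier       = ∣ A ∣
    ; _≈_           = Cg R
    ; ≈-equivalence = record
      { refl  = ≈⇒Cg (IsEquivalence.refl ≈-equivalence)
      ; sym   = Cg-sym
      ; trans = Cg-trans
      }
    ; op            = op
    ; op-cong       = Cg-cong
    ; ⊥             = ⊥
    ; ⊤             = ⊤
    }

------------------------------------------------------------------------
-- Generated subalgebras

module _ (A : Algebra) {m : ℕ} (g : Fin m → ∣ A ∣) where
  open Algebra A

  data Generated : Pred ∣ A ∣ 0ℓ where
    gen   : ∀ i → Generated (g i)
    gen-⊥ : Generated ⊥
    gen-⊤ : Generated ⊤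
    gen-∙ : ∀ o {x y} → Generated x → Generated y → Generated (op o x y)

  Sg : Algebra
  Sg = record
    { Carrier       = Σ ∣ A ∣ Generated
    ; _≈_           = _≈_ on proj₁
    ; ≈-equivalence = On.isEquivalence proj₁ ≈-equivalence
    ; op            = λ o (x , p) (y , q) → op o x y , gen-∙ o p q
    ; op-cong       = λ o → op-cong o
    ; ⊥             = ⊥ , gen-⊥
    ; ⊤             = ⊤ , gen-⊤
    }

------------------------------------------------------------------------
-- Terms, equations and varieties

data Term (X : Set) : Set where
  var   : X → Term X
  op    : BinOp → Term X → Term X → Term X
  ⊥ ⊤   : Term X

TermAlgebra : Set → Algebra
TermAlgebra X = record
  { Carrier       = Term X
  ; _≈_           = _≡_
  ; ≈-equivalence = isEquivalence
  ; op            = op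
  ; op-cong       = λ o → cong₂ (op o)
  ; ⊥             = ⊥
  ; ⊤             = ⊤
  }

module _ (A : Algebra) {X : Set} where
  private module A = Algebra A

  eval : (X → A.Carrier) → Term X → A.Carrier
  eval ρ (var x)    = ρ x
  eval ρ (op o s t) = A.op o (eval ρ s) (eval ρ t)
  eval ρ ⊥          = A.⊥
  eval ρ ⊤          = A.⊤

Equations : Set₁
Equations = Rel (Term ℕ) 0ℓ

-- The variety (equational class) axiomatised by E.

Mod : Equations → Pred Algebra 0ℓ
Mod E A = ∀ s t → E s t → ∀ ρ → Algebra._≈_ A (eval A ρ s) (eval A ρ t)

IsDoubleHeytingVariety : Equations → Set₁
IsDoubleHeytingVariety E = ∀ A → Mod E A → IsDoubleHeyting A

-- Evaluation in the term algebra is substitution.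

data Instance (E : Equations) (X : Set) : Rel (Term X) 0ℓ where
  inst : ∀ {s t} → E s t → (σ : ℕ → Term X) →
         Instance E X (eval (TermAlgebra X) σ s) (eval (TermAlgebra X) σ t)

-- The free algebra of Mod E over X: by completeness of equational logic, the
-- congruence generated by the instances of E identifies exactly the pairs of
-- terms that are equal throughout Mod E.

Free : Equations → Set → Algebra
Free E X = TermAlgebra X /Cg Instance E X

FinitelyPresented : Equations → Pred Algebra 0ℓ
FinitelyPresented E A =
  ∃₂ λ (n : ℕ) (rs : List (Term (Fin n) × Term (Fin n))) →
    A ≅ Free E (Fin n) /Cg (λ s t → (s , t) ∈ rs)

Coherent : Equations → Set₁
Coherent E = ∀ A → Mod E A → FinitelyPresented E A →
             ∀ m (g : Fin m → ∣ A ∣) → FinitelyPresented E (Sg A g)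

-- Mod E is the least variety containing K.

Generates : Pred Algebra 0ℓ → Equations → Set₁
Generates K E = K ⊆ Mod E × (∀ E′ → K ⊆ Mod E′ → Mod E ⊆ Mod E′)

IsDiscriminatorTerm : Term (Fin 3) → Pred Algebra 0ℓ
IsDiscriminatorTerm d A =
  (∀ a c → value a a c ≈ c) × (∀ a b c → ¬ (a ≈ b) → value a b c ≈ a)
  where
  open Algebra A using (_≈_)
  value : ∣ A ∣ → ∣ A ∣ → ∣ A ∣ → ∣ A ∣
  value a b c = eval A (a ∷ b ∷ c ∷ []) d

IsDiscriminatorVariety : Equations → Set₁
IsDiscriminatorVariety E =
  ∃₂ λ (K : Pred Algebra 0ℓ) (d : Term (Fin 3)) →
    K ⊆ IsDiscriminatorTerm d × Generates K E

------------------------------------------------------------------------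
-- Completions and canonical extensions

module _ (P : Poset 0ℓ 0ℓ 0ℓ) where
  open Poset P renaming (Carrier to X)

  IsLub IsGlb : ∀ {ℓ} → Pred X ℓ → Pred X ℓ
  IsLub S x = (∀ {s} → S s → s ≤ x) × (∀ y → (∀ {s} → S s → s ≤ y) → x ≤ y)
  IsGlb S x = (∀ {s} → S s → x ≤ s) × (∀ y → (∀ {s} → S s → y ≤ s) → y ≤ x)

record CompleteLattice : Set₂ where
  field
    poset : Poset 0ℓ 0ℓ 0ℓ

  open Poset poset public

  field
    ⋁ ⋀   : Pred Carrier 1ℓ → Carrier
    ⋁-lub : ∀ S → IsLub poset S (⋁ S)
    ⋀-glb : ∀ S → IsGlb poset S (⋀ S)

  ⋁-cong : ∀ {S T} → S ≐ T → ⋁ S ≈ ⋁ T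
  ⋁-cong {S} {T} (S⊆T , T⊆S) = antisym
    (proj₂ (⋁-lub S) _ (λ s → proj₁ (⋁-lub T) (S⊆T s)))
    (proj₂ (⋁-lub T) _ (λ t → proj₁ (⋁-lub S) (T⊆S t)))

  ⋀-cong : ∀ {S T} → S ≐ T → ⋀ S ≈ ⋀ T
  ⋀-cong {S} {T} (S⊆T , T⊆S) = antisym
    (proj₂ (⋀-glb T) _ (λ t → proj₁ (⋀-glb S) (T⊆S t)))
    (proj₂ (⋀-glb S) _ (λ s → proj₁ (⋀-glb T) (S⊆T s)))

  finite : List⁺ Carrier → Pred Carrier 1ℓ
  finite xs x = Lift 1ℓ (x ∈ toList xs)

record IsCompletion (P : Poset 0ℓ 0ℓ 0ℓ) (C : CompleteLattice)
                    (e : Poset.Carrier P → CompleteLattice.Carrier C) : Set where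
  private
    module P = Poset P
    module C = CompleteLattice C
  field
    isOrderEmbedding : IsOrderMonomorphism P._≈_ C._≈_ P._≤_ C._≤_ e
    preservesMeets   : ∀ (xs : List P.Carrier) m →
                       IsGlb P (_∈ xs) m → IsGlb C.poset (_∈ map e xs) (e m)
    preservesJoins   : ∀ (xs : List P.Carrier) m →
                       IsLub P (_∈ xs) m → IsLub C.poset (_∈ map e xs) (e m)

module _ (P : Poset 0ℓ 0ℓ 0ℓ) (C : CompleteLattice)
         (e : Poset.Carrier P → CompleteLattice.Carrier C) where
  private module P = Poset P
  open CompleteLattice C

  image : Pred P.Carrier 0ℓ → Pred Carrier 1ℓ
  image S x = Lift 1ℓ (∃ λ a → S a × x ≈ e a)

  Open Closed : Pred Carrier 1ℓ
  Open   x = ∃ λ (S : Pred P.Carrier 0ℓ) → Satisfiable S × x ≈ ⋁ (image S)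
  Closed x = ∃ λ (S : Pred P.Carrier 0ℓ) → Satisfiable S × x ≈ ⋀ (image S)

  Dense : Set₂
  Dense = ∀ x → (∃ λ (S : Pred Carrier 1ℓ) → S ⊆ Closed × x ≈ ⋁ S)
              × (∃ λ (S : Pred Carrier 1ℓ) → S ⊆ Open   × x ≈ ⋀ S)

  Compact : Set₂
  Compact = ∀ (S T : Pred Carrier 1ℓ) → Satisfiable S → Satisfiable T →
            S ⊆ Closed → T ⊆ Open →
            ⋀ S ≤ ⋁ T ⇔
            (∃₂ λ S₀ T₀ → finite S₀ ⊆ S × finite T₀ ⊆ T ×
                          ⋀ (finite S₀) ≤ ⋁ (finite T₀))

  record IsCanonicalExtension : Set₂ where
    field
      isCompletion : IsCompletion P C e
      dense        : Dense
      compact      : Compact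

  module _ {n : ℕ} (f : Vector P.Carrier n → P.Carrier) where

    values : Vector Carrier n → Vector Carrier n → Pred Carrier 1ℓ
    values p q y = Lift 1ℓ (∃ λ (a : Vector P.Carrier n) →
      (∀ i → p i ≤ e (a i)) × (∀ i → e (a i) ≤ q i) × y ≈ e (f a))

    Interval : Vector Carrier n → Vector Carrier n → Vector Carrier n → Set₁
    Interval x p q = (∀ i → Closed (p i)) × (∀ i → Open (q i)) ×
                     (∀ i → p i ≤ x i) × (∀ i → x i ≤ q i)

    σ-ext π-ext : Vector Carrier n → Carrier
    σ-ext x = ⋁ (λ y → ∃₂ λ p q → Interval x p q × y ≈ ⋀ (values p q))
    π-ext x = ⋀ (λ y → ∃₂ λ p q → Interval x p q × y ≈ ⋁ (values p q))

    private
      Interval-resp : ∀ {x x′ p q} → (∀ i → x i ≈ x′ i) → Interval x p q → Interval x′ p q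
      Interval-resp x≈x′ (p∈K , q∈O , p≤x , x≤q) =
        p∈K , q∈O , (λ i → ≤-respʳ-≈ (x≈x′ i) (p≤x i)) , (λ i → ≤-respˡ-≈ (x≈x′ i) (x≤q i))

    σ-ext-cong : ∀ {x x′} → (∀ i → x i ≈ x′ i) → σ-ext x ≈ σ-ext x′
    σ-ext-cong x≈x′ = ⋁-cong
      ( (λ (p , q , I , y≈) → p , q , Interval-resp x≈x′ I , y≈)
      , (λ (p , q , I , y≈) → p , q , Interval-resp (λ i → Eq.sym (x≈x′ i)) I , y≈))

    π-ext-cong : ∀ {x x′} → (∀ i → x i ≈ x′ i) → π-ext x ≈ π-ext x′
    π-ext-cong x≈x′ = ⋀-cong
      ( (λ (p , q , I , y≈) → p , q , Interval-resp x≈x′ I , y≈)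
      , (λ (p , q , I , y≈) → p , q , Interval-resp (λ i → Eq.sym (x≈x′ i)) I , y≈))

------------------------------------------------------------------------
-- Canonical extensions of double-Heyting algebras

module _ (A : Algebra) (dh : IsDoubleHeyting A) (C : CompleteLattice)
         (e : ∣ A ∣ → CompleteLattice.Carrier C) where
  private
    module A = Algebra A
    module C = CompleteLattice C
    P = IsDoubleHeyting.poset dh

    uncurried : BinOp → Vector A.Carrier 2 → A.Carrier
    uncurried o v = A.op o (v zero) (v (suc zero))

    opᶜ : BinOp → Vector C.Carrier 2 → C.Carrier
    opᶜ meet = σ-ext P C e (uncurried meet)
    opᶜ join = σ-ext P C e (uncurried join)
    opᶜ imp  = π-ext P C e (uncurried imp)
    opᶜ sub  = σ-ext P C e (uncurried sub)

    opᶜ-cong : ∀ o {v w} → (∀ i → v i C.≈ w i) → opᶜ o v C.≈ opᶜ o w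
    opᶜ-cong meet = σ-ext-cong P C e (uncurried meet)
    opᶜ-cong join = σ-ext-cong P C e (uncurried join)
    opᶜ-cong imp  = π-ext-cong P C e (uncurried imp)
    opᶜ-cong sub  = σ-ext-cong P C e (uncurried sub)

  canonicalAlgebra : Algebra
  canonicalAlgebra = record
    { Carrier       = C.Carrier
    ; _≈_           = C._≈_
    ; ≈-equivalence = C.isEquivalence
    ; op            = λ o x y → opᶜ o (x ∷ y ∷ [])
    ; op-cong       = λ o x≈x′ y≈y′ → opᶜ-cong o λ { zero → x≈x′ ; (suc zero) → y≈y′ }
    ; ⊥             = e A.⊥
    ; ⊤             = e A.⊤
    }

-- A canonical extension is unique only up to isomorphism, so membership is
-- required of every one of them.

ClosedUnderCanonicalExtensions : (E : Equations) → IsDoubleHeytingVariety E → Set₂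
ClosedUnderCanonicalExtensions E dhv =
  ∀ A (A∈E : Mod E A) (C : CompleteLattice) e →
  let dh = dhv A A∈E in
  IsCanonicalExtension (IsDoubleHeyting.poset dh) C e →
  Mod E (canonicalAlgebra A dh C e)

{-# OPTIONS --safe #-}
module Submission where

-- Put □x = ¬∼x (box below), a deflationary monotone operation.  In a complete double-Heyting
-- algebra the meet y of the □ᵏx satisfies y ≤ □y, so by passing to a canonical extension the
-- consequences in x, z of the relations z ≤ y ≤ x, y ≤ □y are axiomatised by
-- {z ≤ □ᵏx : k ∈ ℕ}.  Coherence makes finitely many of these consequences sufficient, hence
-- one relation z ≤ □ⁿx, which therefore implies z ≤ □ⁿ⁺¹x; taking z = □ⁿx, the variety
-- satisfies □ⁿx ≤ □ⁿ⁺¹x.  Then δ = □ⁿ((x ⇨ y) ∧ (y ⇨ x)) is complemented, and in quotients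
-- by ultrafilters of complemented elements it is ⊤ or ⊥ according to whether x = y; so
-- (δ ∧ z) ∨ (¬δ ∧ x) is a discriminator there.  No choice is needed: an equation that fails
-- in some algebra fails in a countable one, whose ultrafilters are built step by step.

open import Level using (Level; 0ℓ; Lift; lift)
open import Axiom.ExcludedMiddle using (ExcludedMiddle)
open import Data.Bool using (Bool; T)
open import Data.Fin using (Fin; zero; suc)
open import Data.Fin.Properties using (_≟_)
open import Data.List
  using (List; []; _∷_; _++_; map; foldr; concatMap; cartesianProductWith; allFin)
open import Data.List.NonEmpty using () renaming (_∷_ to _∷⁺_)
open import Data.List.Membership.Propositional using (_∈_; lose)
open import Data.List.Membership.Propositional.Properties
  using (∈-map⁺; ∈-map⁻; ∈-++⁺ˡ; ∈-++⁺ʳ; ∈-allFin; ∈-concatMap⁺; ∈-cartesianProductWith⁺)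
open import Data.List.Relation.Binary.Subset.Propositional using () renaming (_⊆_ to _⊆ˡ_)
open import Data.List.Relation.Unary.All as All using (All; []; _∷_)
open import Data.List.Relation.Unary.All.Properties using (++⁺; map⁺)
open import Data.List.Relation.Unary.Any using (here; there)
open import Data.Nat using (ℕ; zero; suc; _⊔_; z≤n; s≤s; _≤′_; ≤′-reflexive; ≤′-step)
  renaming (_≤_ to _≤ᴺ_)
open import Data.Nat.Properties using (m≤m⊔n; m≤n⊔m; ≤⇒≤′)
open import Data.Product using (∃; ∃₂; _×_; _,_; proj₁; proj₂)
open import Data.Sum as Sum using (_⊎_; inj₁; inj₂)
open import Data.Vec.Functional using (Vector) renaming ([] to []ᵛ; _∷_ to _∷ᵛ_)
open import Function using (_∘_; Equivalence; mk⇔)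
open import Relation.Binary using (Rel; Setoid; Poset)
open import Relation.Binary.Lattice.Bundles using (HeytingAlgebra; BoundedLattice)
open import Relation.Binary.Morphism.Structures using (IsOrderMonomorphism)
open import Relation.Binary.PropositionalEquality as ≡ using (_≡_)
open import Relation.Nullary as Nullary using (yes; no; contradiction)
open import Relation.Nullary.Decidable using (isYes; toWitness; fromWitness)
open import Relation.Unary using (Pred)
import Relation.Binary.Lattice.Properties.HeytingAlgebra as HeytingProperties
open import Defs

open Algebra using () renaming (Carrier to ∣_∣)

-- Term evaluation, free algebras and presented algebras.

setoid : Algebra → Setoid 0ℓ 0ℓ
setoid A = record { isEquivalence = Algebra.≈-equivalence A }

Cg-sound : ∀ {A B R h} → IsHomomorphism A B h →
           (∀ {x y} → R x y → Algebra._≈_ B (h x) (h y)) →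
           ∀ {x y} → Cg A R x y → Algebra._≈_ B (h x) (h y)
Cg-sound {A} {B} {R} {h} hom R⊆ker = go
  where
  open Setoid (setoid B)
  module h = IsHomomorphism hom

  go : ∀ {x y} → Cg A R x y → h x ≈ h y
  go (base r)       = R⊆ker r
  go (≈⇒Cg x≈y)     = h.≈-cong x≈y
  go (Cg-sym p)     = sym (go p)
  go (Cg-trans p q) = trans (go p) (go q)
  go (Cg-cong o p q) =
    trans (h.homo o _ _) (trans (Algebra.op-cong B o (go p) (go q)) (sym (h.homo o _ _)))

module _ (A : Algebra) where
  open Setoid (setoid A)
  private module A = Algebra A

  eval-cong : ∀ {X : Set} {ρ ρ′ : X → ∣ A ∣} → (∀ i → ρ i ≈ ρ′ i) →
              ∀ s → eval A ρ s ≈ eval A ρ′ s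
  eval-cong ρ≈ (var i)    = ρ≈ i
  eval-cong ρ≈ (op o s t) = A.op-cong o (eval-cong ρ≈ s) (eval-cong ρ≈ t)
  eval-cong ρ≈ ⊥          = refl
  eval-cong ρ≈ ⊤          = refl

  eval-isHomomorphism : ∀ {X} (ρ : X → ∣ A ∣) → IsHomomorphism (TermAlgebra X) A (eval A ρ)
  eval-isHomomorphism ρ = record
    { ≈-cong = λ { ≡.refl → refl } ; ⊥-homo = refl ; ⊤-homo = refl ; homo = λ _ _ _ → refl }

  eval-homo : ∀ {B h} → IsHomomorphism A B h → ∀ {X : Set} (ρ : X → ∣ A ∣) s →
              Algebra._≈_ B (h (eval A ρ s)) (eval B (h ∘ ρ) s)
  eval-homo {B} {h} hom ρ = go
    where
    module B = Setoid (setoid B)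
    module h = IsHomomorphism hom

    go : ∀ s → h (eval A ρ s) B.≈ eval B (h ∘ ρ) s
    go (var i)    = B.refl
    go (op o s t) = B.trans (h.homo o _ _) (Algebra.op-cong B o (go s) (go t))
    go ⊥          = h.⊥-homo
    go ⊤          = h.⊤-homo

  -- Carrier and operations are those of `A`, but `eval` recurses on the term, so the equality needs
  -- an induction and does not hold by computation alone.
  eval-/Cg : ∀ R {X : Set} (ρ : X → ∣ A ∣) s → eval (A /Cg R) ρ s ≡ eval A ρ s
  eval-/Cg R ρ (var i)    = ≡.refl
  eval-/Cg R ρ (op o s t) = ≡.cong₂ (A.op o) (eval-/Cg R ρ s) (eval-/Cg R ρ t)
  eval-/Cg R ρ ⊥          = ≡.refl
  eval-/Cg R ρ ⊤          = ≡.refl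

eval-substitute : ∀ A {X Y : Set} (ρ : Y → ∣ A ∣) (σ : X → Term Y) s →
                  Algebra._≈_ A (eval A ρ (eval (TermAlgebra Y) σ s)) (eval A (eval A ρ ∘ σ) s)
eval-substitute A ρ = eval-homo (TermAlgebra _) (eval-isHomomorphism A ρ)

eval-var : ∀ {X : Set} (s : Term X) → eval (TermAlgebra X) var s ≡ s
eval-var (var i)    = ≡.refl
eval-var (op o s t) = ≡.cong₂ (op o) (eval-var s) (eval-var t)
eval-var ⊥          = ≡.refl
eval-var ⊤          = ≡.refl

/Cg-∈Mod : ∀ {E} A R → Mod E A → Mod E (A /Cg R)
/Cg-∈Mod A R A∈E s t e ρ
  rewrite eval-/Cg A R ρ s | eval-/Cg A R ρ t = ≈⇒Cg (A∈E s t e ρ)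

Free-∈Mod : ∀ E X → Mod E (Free E X)
Free-∈Mod E X s t e ρ
  rewrite eval-/Cg (TermAlgebra X) (Instance E X) ρ s
        | eval-/Cg (TermAlgebra X) (Instance E X) ρ t = base (inst e ρ)

module _ {E : Equations} (B : Algebra) (B∈E : Mod E B) {X : Set} (ρ : X → ∣ B ∣) where
  open Setoid (setoid B)

  Free-sound : ∀ {s t} → Cg (TermAlgebra X) (Instance E X) s t → eval B ρ s ≈ eval B ρ t
  Free-sound = Cg-sound (eval-isHomomorphism B ρ) λ { (inst {s} {t} e σ) →
    trans (eval-substitute B ρ σ s)
      (trans (B∈E s t e (eval B ρ ∘ σ)) (sym (eval-substitute B ρ σ t))) }

  -- The universal property of a presented algebra: `Free-sound` takes care of the equations, so
  -- only the relations `R` have to be checked in `B`.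
  presented-sound : ∀ {R} → (∀ {s t} → R s t → eval B ρ s ≈ eval B ρ t) →
                    ∀ {s t} → Cg (Free E X) R s t → eval B ρ s ≈ eval B ρ t
  presented-sound = Cg-sound {B = B} {h = eval B ρ} record
    { ≈-cong = Free-sound ; ⊥-homo = refl ; ⊤-homo = refl ; homo = λ _ _ _ → refl }

module _ {E : Equations} {X : Set} (R : Rel (Term X) 0ℓ) where

  presented-∈Mod : Mod E (Free E X /Cg R)
  presented-∈Mod = /Cg-∈Mod (Free E X) R (Free-∈Mod E X)

  eval-presented : ∀ {Y : Set} (σ : Y → Term X) s →
                   eval (Free E X /Cg R) σ s ≡ eval (TermAlgebra X) σ s
  eval-presented σ s = ≡.trans (eval-/Cg (Free E X) R σ s)
    (eval-/Cg (TermAlgebra X) (Instance E X) σ s)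

≅-refl : ∀ A → A ≅ A
≅-refl A = (λ x → x) ,
  record { ≈-cong = λ p → p ; ⊥-homo = refl ; ⊤-homo = refl ; homo = λ _ _ _ → refl } ,
  (λ p → p) , λ y → y , λ p → p
  where open Setoid (setoid A)

-- The operation `box` and complemented elements.

-- Defined for an arbitrary `Algebra`, so that in `TermAlgebra X` the same formula yields the terms
-- which `eval-box^` evaluates.
box : (A : Algebra) → ∣ A ∣ → ∣ A ∣
box A x = (A.⊤ A.- x) A.⇨ A.⊥
  where module A = Algebra A

box^ : (A : Algebra) → ℕ → ∣ A ∣ → ∣ A ∣
box^ A zero    x = x
box^ A (suc k) x = box A (box^ A k x)

eval-box^ : ∀ A {X : Set} (ρ : X → ∣ A ∣) k s →
            eval A ρ (box^ (TermAlgebra X) k s) ≡ box^ A k (eval A ρ s)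
eval-box^ A ρ zero    s = ≡.refl
eval-box^ A ρ (suc k) s = ≡.cong (box A) (eval-box^ A ρ k s)

module DoubleHeyting {A : Algebra} (dh : IsDoubleHeyting A) where
  heytingAlgebra : HeytingAlgebra 0ℓ 0ℓ 0ℓ
  heytingAlgebra = record { isHeytingAlgebra = IsDoubleHeyting.isHeytingAlgebra dh }

  open HeytingAlgebra heytingAlgebra public
    hiding (setoid) renaming (⊤ to 𝟙; ⊥ to 𝟘)
  open Algebra A public using (_-_)
  open HeytingProperties heytingAlgebra public
    using (⇨-eval; swap-transpose-⇨; y≤x⇨y; ⇨ˡ-contravariant; ⇨ʳ-covariant; ∧-distribˡ-∨-≤)

  infix 8 ¬_ ∼_

  ¬_ ∼_ : ∣ A ∣ → ∣ A ∣
  ¬ x = x ⇨ 𝟘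
  ∼ x = 𝟙 - x

  ∧-mono : ∀ {x y u v} → x ≤ y → u ≤ v → x ∧ u ≤ y ∧ v
  ∧-mono x≤y u≤v = ∧-greatest (trans (x∧y≤x _ _) x≤y) (trans (x∧y≤y _ _) u≤v)

  ∨-mono : ∀ {x y u v} → x ≤ y → u ≤ v → x ∨ u ≤ y ∨ v
  ∨-mono x≤y u≤v = ∨-least (trans x≤y (x≤x∨y _ _)) (trans u≤v (y≤x∨y _ _))

  ∨-swap : ∀ {x y} → x ∨ y ≤ y ∨ x
  ∨-swap = ∨-least (y≤x∨y _ _) (x≤x∨y _ _)

  ∧-swap : ∀ {x y} → x ∧ y ≤ y ∧ x
  ∧-swap = ∧-greatest (x∧y≤y _ _) (x∧y≤x _ _)

  transpose-∨ : ∀ {x y z} → x - y ≤ z → x ≤ y ∨ z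
  transpose-∨ = Equivalence.to (IsDoubleHeyting.dualExponential dh _ _ _)

  transpose-- : ∀ {x y z} → x ≤ y ∨ z → x - y ≤ z
  transpose-- = Equivalence.from (IsDoubleHeyting.dualExponential dh _ _ _)

  x∨∼x : ∀ x → 𝟙 ≤ x ∨ ∼ x
  x∨∼x x = transpose-∨ refl

  ¬x∧x : ∀ x → ¬ x ∧ x ≤ 𝟘
  ¬x∧x x = ⇨-eval

  -- Residuation stands in for distributivity: `b` and `c` both lie below `x ⇨ y`, hence so does
  -- `𝟙`.
  by-cases : ∀ {b c x y} → 𝟙 ≤ b ∨ c → b ∧ x ≤ y → c ∧ x ≤ y → x ≤ y
  by-cases 𝟙≤b∨c p q = trans (∧-greatest (maximum _) refl)
    (transpose-∧ (trans 𝟙≤b∨c (∨-least (transpose-⇨ p) (transpose-⇨ q))))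

  -- Split along `x ∨ ∼ x`: on the second part `box A x`, which is `¬ ∼ x`, vanishes.
  box-deflationary : ∀ x → box A x ≤ x
  box-deflationary x = by-cases (x∨∼x x) (x∧y≤x _ _)
    (trans ∧-swap (trans (¬x∧x (∼ x)) (minimum _)))

  box-mono : ∀ {x y} → x ≤ y → box A x ≤ box A y
  box-mono x≤y = ⇨ˡ-contravariant
    (transpose-- (trans (x∨∼x _) (∨-mono x≤y refl)))

  box^-deflationary : ∀ k x → box^ A k x ≤ x
  box^-deflationary zero    x = refl
  box^-deflationary (suc k) x = trans (box-deflationary _) (box^-deflationary k x)

  box^-antitone : ∀ {j k} → j ≤ᴺ k → ∀ x → box^ A k x ≤ box^ A j x
  box^-antitone {k = zero}  z≤n       x = refl
  box^-antitone {k = suc k} z≤n       x = box^-deflationary (suc k) x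
  box^-antitone             (s≤s j≤k) x = box-mono (box^-antitone j≤k x)

  Complemented : ∣ A ∣ → Set
  Complemented b = 𝟙 ≤ b ∨ ¬ b

  -- Transposing, `b ≤ ¬ ∼ b` means `∼ b ≤ ¬ b`, which by dual residuation is `𝟙 ≤ b ∨ ¬ b`.
  -- Together with `complemented⇒≤box`, the fixed points of `box` are exactly the complemented
  -- elements.
  ≤box⇒complemented : ∀ {b} → b ≤ box A b → Complemented b
  ≤box⇒complemented b≤box = transpose-∨ (transpose-⇨
    (trans (∧-mono refl b≤box) (trans ∧-swap (¬x∧x _))))

  complemented⇒≤box : ∀ {b} → Complemented b → b ≤ box A b
  complemented⇒≤box c = swap-transpose-⇨
    (trans (∧-mono (transpose-- c) refl) (¬x∧x _))

  complemented⇒≤box^ : ∀ {b x} → Complemented b → b ≤ x → ∀ k → b ≤ box^ A k x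
  complemented⇒≤box^ c b≤x zero    = b≤x
  complemented⇒≤box^ c b≤x (suc k) =
    trans (complemented⇒≤box c) (box-mono (complemented⇒≤box^ c b≤x k))

  ¬-complemented : ∀ {b} → Complemented b → Complemented (¬ b)
  ¬-complemented c = trans c (trans ∨-swap
    (∨-mono refl (swap-transpose-⇨ (¬x∧x _))))

  -- `¬ b` and `¬ c` lie below `¬ (b ∧ c)`, so `∼ ¬ (b ∧ c)` lies below both `b` and `c`; dual
  -- residuation then does the work of distributing join over meet.
  ∧-complemented : ∀ {b c} → Complemented b → Complemented c → Complemented (b ∧ c)
  ∧-complemented {b} {c} p q = trans (transpose-∨ (∧-greatest
    (transpose-- (trans p (trans ∨-swap (∨-mono (⇨ˡ-contravariant (x∧y≤x _ _)) refl))))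
    (transpose-- (trans q (trans ∨-swap (∨-mono (⇨ˡ-contravariant (x∧y≤y _ _)) refl))))))
    ∨-swap

-- The canonical extension of a bounded lattice, built from filters and ideals.

module CanonicalExtension
  (em : ∀ {ℓ : Level} → ExcludedMiddle ℓ) (L : BoundedLattice 0ℓ 0ℓ 0ℓ) where
  private module L = BoundedLattice L
  open L using (_∧_; _∨_; _≤_) renaming (Carrier to D; ⊤ to 𝟙; ⊥ to 𝟘)

  -- Excluded middle makes predicates of every level `Bool`-valued. This keeps `Subset` and `Family`
  -- in `Set`, although meets and joins range over predicates in `Set₁`.
  ⌈_⌉ : ∀ {ℓ} → Set ℓ → Bool
  ⌈ P ⌉ = isYes (em {P = P})

  into : ∀ {ℓ} {P : Set ℓ} → P → T ⌈ P ⌉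
  into = fromWitness

  out : ∀ {ℓ} {P : Set ℓ} → T ⌈ P ⌉ → P
  out = toWitness

  Subset : Set
  Subset = D → Bool

  comprehension : ∀ {ℓ} → Pred D ℓ → Subset
  comprehension P a = ⌈ P a ⌉

  ⋀ᶠ ⋁ᶠ : List D → D
  ⋀ᶠ = foldr _∧_ 𝟙
  ⋁ᶠ = foldr _∨_ 𝟘

  infix 4 _⊢_ _⊣_ _≬_ _⊑_

  -- Subsets F and I stand for the filter and the ideal that they generate.

  _⊢_ : Subset → D → Set
  F ⊢ a = ∃ λ xs → All (T ∘ F) xs × ⋀ᶠ xs ≤ a

  _⊣_ : D → Subset → Set
  a ⊣ I = ∃ λ xs → All (T ∘ I) xs × a ≤ ⋁ᶠ xs

  _≬_ : Subset → Subset → Set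
  F ≬ I = ∃ λ a → F ⊢ a × a ⊣ I

  ⊢-gen : ∀ {F a} → T (F a) → F ⊢ a
  ⊢-gen {a = a} a∈F = a ∷ [] , a∈F ∷ [] , L.x∧y≤x _ _

  ⊢-up : ∀ {F a b} → F ⊢ a → a ≤ b → F ⊢ b
  ⊢-up (xs , xs⊆F , p) a≤b = xs , xs⊆F , L.trans p a≤b

  ⋀ᶠ-lower : ∀ {xs x} → x ∈ xs → ⋀ᶠ xs ≤ x
  ⋀ᶠ-lower (here ≡.refl) = L.x∧y≤x _ _
  ⋀ᶠ-lower (there x∈xs)  = L.trans (L.x∧y≤y _ _) (⋀ᶠ-lower x∈xs)

  ⋁ᶠ-upper : ∀ {xs x} → x ∈ xs → x ≤ ⋁ᶠ xs
  ⋁ᶠ-upper (here ≡.refl) = L.x≤x∨y _ _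
  ⋁ᶠ-upper (there x∈xs)  = L.trans (⋁ᶠ-upper x∈xs) (L.y≤x∨y _ _)

  ⋀ᶠ-++ : ∀ xs {ys} → ⋀ᶠ (xs ++ ys) ≤ ⋀ᶠ xs ∧ ⋀ᶠ ys
  ⋀ᶠ-++ []       = L.∧-greatest (L.maximum _) L.refl
  ⋀ᶠ-++ (x ∷ xs) = L.∧-greatest
    (L.∧-greatest (L.x∧y≤x _ _) (L.trans (L.x∧y≤y _ _) (L.trans (⋀ᶠ-++ xs) (L.x∧y≤x _ _))))
    (L.trans (L.x∧y≤y _ _) (L.trans (⋀ᶠ-++ xs) (L.x∧y≤y _ _)))

  ⋁ᶠ-++ : ∀ xs {ys} → ⋁ᶠ xs ∨ ⋁ᶠ ys ≤ ⋁ᶠ (xs ++ ys)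
  ⋁ᶠ-++ []       = L.∨-least (L.minimum _) L.refl
  ⋁ᶠ-++ (x ∷ xs) = L.∨-least
    (L.∨-least (L.x≤x∨y _ _) (L.trans (L.trans (L.x≤x∨y _ _) (⋁ᶠ-++ xs)) (L.y≤x∨y _ _)))
    (L.trans (L.trans (L.y≤x∨y _ _) (⋁ᶠ-++ xs)) (L.y≤x∨y _ _))

  ⊢-∧ : ∀ {F a b} → F ⊢ a → F ⊢ b → F ⊢ a ∧ b
  ⊢-∧ (xs , xs⊆F , p) (ys , ys⊆F , q) = xs ++ ys , ++⁺ xs⊆F ys⊆F , L.trans (⋀ᶠ-++ xs)
    (L.∧-greatest (L.trans (L.x∧y≤x _ _) p) (L.trans (L.x∧y≤y _ _) q))

  ⊢-⋀ᶠ : ∀ {F xs} → All (F ⊢_) xs → F ⊢ ⋀ᶠ xs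
  ⊢-⋀ᶠ []       = [] , [] , L.refl
  ⊢-⋀ᶠ (p ∷ ps) = ⊢-∧ p (⊢-⋀ᶠ ps)

  ⊣-gen : ∀ {I a} → T (I a) → a ⊣ I
  ⊣-gen {a = a} a∈I = a ∷ [] , a∈I ∷ [] , L.x≤x∨y _ _

  ⊣-down : ∀ {I a b} → a ≤ b → b ⊣ I → a ⊣ I
  ⊣-down a≤b (xs , xs⊆I , p) = xs , xs⊆I , L.trans a≤b p

  ⊣-∨ : ∀ {I a b} → a ⊣ I → b ⊣ I → a ∨ b ⊣ I
  ⊣-∨ (xs , xs⊆I , p) (ys , ys⊆I , q) = xs ++ ys , ++⁺ xs⊆I ys⊆I , L.trans
    (L.∨-least (L.trans p (L.x≤x∨y _ _)) (L.trans q (L.y≤x∨y _ _))) (⋁ᶠ-++ xs)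

  ⊣-⋁ᶠ : ∀ {I xs} → All (_⊣ I) xs → ⋁ᶠ xs ⊣ I
  ⊣-⋁ᶠ []       = [] , [] , L.refl
  ⊣-⋁ᶠ (p ∷ ps) = ⊣-∨ p (⊣-⋁ᶠ ps)

  ⊢-principal : ∀ a → comprehension (_≡ a) ⊢ a
  ⊢-principal a = ⊢-gen (into ≡.refl)

  principal-⊢ : ∀ {a b} → comprehension (_≡ a) ⊢ b → a ≤ b
  principal-⊢ {a} (xs , xs⊆ , p) = L.trans (go xs⊆) p
    where
    go : ∀ {xs} → All (T ∘ comprehension (_≡ a)) xs → a ≤ ⋀ᶠ xs
    go []             = L.maximum _
    go (x∈ ∷ xs⊆) with ≡.refl ← out x∈ = L.∧-greatest L.refl (go xs⊆)

  ⊣-principal : ∀ a → a ⊣ comprehension (_≡ a)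
  ⊣-principal a = ⊣-gen (into ≡.refl)

  principal-⊣ : ∀ {a b} → b ⊣ comprehension (_≡ a) → b ≤ a
  principal-⊣ {a} (xs , xs⊆ , p) = L.trans p (go xs⊆)
    where
    go : ∀ {xs} → All (T ∘ comprehension (_≡ a)) xs → ⋁ᶠ xs ≤ a
    go []             = L.minimum _
    go (x∈ ∷ xs⊆) with ≡.refl ← out x∈ = L.∨-least L.refl (go xs⊆)

  -- A family of subsets F stands for the join of the closed elements κ F, and
  -- families are compared by their open upper bounds ω I.

  Family : Set
  Family = Subset → Bool

  IsUpper : Family → Subset → Set
  IsUpper U I = ∀ F → T (U F) → F ≬ I

  IsBelow : Subset → Family → Set
  IsBelow F U = ∀ I → IsUpper U I → F ≬ I

  _⊑_ : Rel Family 0ℓ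
  U ⊑ V = ∀ I → IsUpper V I → IsUpper U I

  ∈⇒below : ∀ {U F} → T (U F) → IsBelow F U
  ∈⇒below F∈U I I-upper = I-upper _ F∈U

  ⊆⇒⊑ : ∀ {U V} → (∀ F → T (U F) → T (V F)) → U ⊑ V
  ⊆⇒⊑ U⊆V I I-upper F F∈U = I-upper F (U⊆V F F∈U)

  family-poset : Poset 0ℓ 0ℓ 0ℓ
  family-poset = record
    { Carrier = Family
    ; _≈_ = λ U V → U ⊑ V × V ⊑ U
    ; _≤_ = _⊑_
    ; isPartialOrder = record
      { isPreorder = record
        { isEquivalence = record
          { refl  = (λ I p → p) , (λ I p → p)
          ; sym   = λ (p , q) → q , p
          ; trans = λ (p , q) (r , s) → (λ I → p I ∘ r I) , (λ I → s I ∘ q I)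
          }
        ; reflexive = proj₁
        ; trans = λ p q I → p I ∘ q I
        }
      ; antisym = _,_
      }
    }

  -- The complete lattice of Galois-closed sets for the polarity `≬` between filters and ideals.
  -- Families up to mutual `⊑` replace closed sets, so a join is a plain union without a closure
  -- operator.
  completion : CompleteLattice
  completion = record
    { poset = family-poset
    ; ⋁ = λ S F → ⌈ (∃ λ U → S U × T (U F)) ⌉
    ; ⋀ = λ S F → ⌈ (∀ U → S U → IsBelow F U) ⌉
    ; ⋁-lub = λ S →
        (λ U∈S → ⊆⇒⊑ λ F F∈U → into (_ , U∈S , F∈U))
      , (λ V S⊑V I I-upper F F∈ → let (U , U∈S , F∈U) = out F∈ in S⊑V U∈S I I-upper F F∈U)
    ; ⋀-glb = λ S →
        (λ U∈S I I-upper F F∈ → out F∈ _ U∈S I I-upper)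
      , (λ V V⊑S I I-upper F F∈V → I-upper F (into λ U U∈S J J-upper → V⊑S U∈S J J-upper F F∈V))
    }

  open CompleteLattice completion using (⋁; ⋀; ⋁-lub; ⋀-glb; finite)

  ⊑-refl : ∀ {U} → U ⊑ U
  ⊑-refl I p = p

  ⊑-trans : ∀ {U V W} → U ⊑ V → V ⊑ W → U ⊑ W
  ⊑-trans p q I = p I ∘ q I

  ⋁-upper : ∀ S {U} → S U → U ⊑ ⋁ S
  ⋁-upper S = proj₁ (⋁-lub S)

  ⋁-least : ∀ S {V} → (∀ {U} → S U → U ⊑ V) → ⋁ S ⊑ V
  ⋁-least S = proj₂ (⋁-lub S) _

  ⋀-lower : ∀ S {U} → S U → ⋀ S ⊑ U
  ⋀-lower S = proj₁ (⋀-glb S)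

  ⋀-greatest : ∀ S {V} → (∀ {U} → S U → V ⊑ U) → V ⊑ ⋀ S
  ⋀-greatest S = proj₂ (⋀-glb S) _

  -- The typical closed and open elements: the meet of `e a` over one subset and the join over
  -- another, by `⋀-image` and `⋁-image`.
  κ ω : Subset → Family
  κ F G = ⌈ (∀ a → T (F a) → G ⊢ a) ⌉
  ω I G = ⌈ G ≬ I ⌉

  e : D → Family
  e a G = ⌈ G ⊢ a ⌉

  κ-self : ∀ F → T (κ F F)
  κ-self F = into λ _ → ⊢-gen

  κ-⊢ : ∀ {F G a} → T (κ F G) → F ⊢ a → G ⊢ a
  κ-⊢ G∈ (xs , xs⊆F , p) = ⊢-up (⊢-⋀ᶠ (All.map (out G∈ _) xs⊆F)) p

  below⇒κ⊑ : ∀ {F U} → IsBelow F U → κ F ⊑ U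
  below⇒κ⊑ F-below I I-upper G G∈ =
    let (a , F⊢a , a⊣I) = F-below I I-upper in a , κ-⊢ G∈ F⊢a , a⊣I

  upper⇒⊑ω : ∀ {I U} → IsUpper U I → U ⊑ ω I
  upper⇒⊑ω I-upper = ⊆⇒⊑ λ F F∈U → into (I-upper F F∈U)

  ω-upper : ∀ {I U} → U ⊑ ω I → IsUpper U I
  ω-upper {I} U⊑ω = U⊑ω I λ G → out

  κ⊑ω⇒≬ : ∀ {F I} → κ F ⊑ ω I → F ≬ I
  κ⊑ω⇒≬ {F} κ⊑ω = ω-upper κ⊑ω F (κ-self F)

  -- The principal ideal of `a` is an upper bound of `e a`, hence of `U`, so the filter of `F` meets
  -- it.
  ⊑e⇒⊢ : ∀ {U a F} → U ⊑ e a → T (U F) → F ⊢ a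
  ⊑e⇒⊢ {a = a} U⊑e F∈U =
    let (b , F⊢b , b⊣) = U⊑e (comprehension (_≡ a)) (λ G G∈ → a , out G∈ , ⊣-principal a) _ F∈U
    in ⊢-up F⊢b (principal-⊣ b⊣)

  ⊢⇒⊑e : ∀ {U a} → (∀ F → T (U F) → F ⊢ a) → U ⊑ e a
  ⊢⇒⊑e p = ⊆⇒⊑ λ F F∈U → into (p F F∈U)

  ⊣⇒upper : ∀ {a I} → a ⊣ I → IsUpper (e a) I
  ⊣⇒upper a⊣I F F∈ = _ , out F∈ , a⊣I

  -- Dually, the principal filter of `a` is a member of `e a`, and testing there is enough.
  e-upper⇒⊣ : ∀ {a I} → IsUpper (e a) I → a ⊣ I
  e-upper⇒⊣ {a} I-upper =
    let (b , ⊢b , b⊣I) = I-upper _ (into (⊢-principal a)) in ⊣-down (principal-⊢ ⊢b) b⊣I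

  e-mono : ∀ {a b} → a ≤ b → e a ⊑ e b
  e-mono a≤b = ⊢⇒⊑e λ F F∈ → ⊢-up (out F∈) a≤b

  e-reflects : ∀ {a b} → e a ⊑ e b → a ≤ b
  e-reflects {a} p = principal-⊢ (⊑e⇒⊢ p (into (⊢-principal a)))

  κ⊑e : ∀ {F a} → F ⊢ a → κ F ⊑ e a
  κ⊑e F⊢a = ⊢⇒⊑e λ G G∈ → κ-⊢ G∈ F⊢a

  e⊑ω : ∀ {I a} → a ⊣ I → e a ⊑ ω I
  e⊑ω a⊣I = upper⇒⊑ω (⊣⇒upper a⊣I)

  κ-greatest : ∀ {F V} → (∀ {a} → T (F a) → V ⊑ e a) → V ⊑ κ F
  κ-greatest V⊑ = ⊆⇒⊑ λ G G∈V → into λ a a∈F → ⊑e⇒⊢ (V⊑ a∈F) G∈V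

  ω-least : ∀ {I V} → (∀ {a} → T (I a) → e a ⊑ V) → ω I ⊑ V
  ω-least ⊑V J J-upper G G∈ =
    let (a , G⊢a , (xs , xs⊆I , a≤)) = out G∈
    in a , G⊢a , ⊣-down a≤ (⊣-⋁ᶠ (All.map (λ x∈I → e-upper⇒⊣ (⊑V x∈I J J-upper)) xs⊆I))

  private
    P = L.poset
    image′ : Pred D 0ℓ → Pred Family 1ℓ
    image′ = image P completion e

  ⋀-image : ∀ S → κ (comprehension S) ⊑ ⋀ (image′ S) × ⋀ (image′ S) ⊑ κ (comprehension S)
  ⋀-image S =
      ⋀-greatest (image′ S) (λ (lift (a , a∈S , _ , e⊑U)) →
        ⊑-trans {V = e a} (κ⊑e (⊢-gen (into a∈S))) e⊑U)
    , κ-greatest (λ a∈ → ⋀-lower (image′ S) (lift (_ , out a∈ , ⊑-refl , ⊑-refl)))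

  ⋁-image : ∀ S → ω (comprehension S) ⊑ ⋁ (image′ S) × ⋁ (image′ S) ⊑ ω (comprehension S)
  ⋁-image S =
      ω-least (λ a∈ → ⋁-upper (image′ S) (lift (_ , out a∈ , ⊑-refl , ⊑-refl)))
    , ⋁-least (image′ S) (λ (lift (a , a∈S , U⊑e , _)) →
        ⊑-trans {V = e a} U⊑e (e⊑ω (⊣-gen (into a∈S))))

  κ-closed : ∀ F → Closed P completion e (κ F)
  -- The generated filter replaces `F`, because `Closed` demands a nonempty set and the filter
  -- always contains `𝟙`.
  κ-closed F = (F ⊢_) , (𝟙 , [] , [] , L.refl) ,
      ⊑-trans {V = κ (comprehension (F ⊢_))} (κ-greatest λ a∈ → κ⊑e (out a∈)) (proj₁ (⋀-image _))
    , ⊑-trans {V = κ (comprehension (F ⊢_))} (proj₂ (⋀-image _))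
        (κ-greatest λ a∈ → κ⊑e (⊢-gen (into (⊢-gen a∈))))

  ω-open : ∀ I → Open P completion e (ω I)
  ω-open I = (_⊣ I) , (𝟘 , [] , [] , L.refl) ,
      ⊑-trans {V = ω (comprehension (_⊣ I))}
        (ω-least λ a∈ → e⊑ω (⊣-gen (into (⊣-gen a∈)))) (proj₁ (⋁-image _))
    , ⊑-trans {V = ω (comprehension (_⊣ I))} (proj₂ (⋁-image _)) (ω-least λ a∈ → e⊑ω (out a∈))

  isCompletion : IsCompletion P completion e
  isCompletion = record
    { isOrderEmbedding = record
      { isOrderHomomorphism = record
        { cong = λ a≈b → e-mono (L.reflexive a≈b) , e-mono (L.reflexive (L.Eq.sym a≈b))
        ; mono = e-mono
        }
      ; injective = λ (p , q) → L.antisym (e-reflects p) (e-reflects q)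
      ; cancel = e-reflects
      }
    ; preservesMeets = λ xs m (m-lower , m-greatest) →
        (λ x∈ → let (a , a∈xs , x≡ea) = ∈-map⁻ e x∈ in
                ≡.subst (e m ⊑_) (≡.sym x≡ea) (e-mono (m-lower a∈xs)))
      , (λ V V⊑ → ⊢⇒⊑e λ F F∈V → ⊢-up
          (⊢-⋀ᶠ (All.tabulate λ x∈xs → ⊑e⇒⊢ (V⊑ (∈-map⁺ e x∈xs)) F∈V))
          (m-greatest _ ⋀ᶠ-lower))
    ; preservesJoins = λ xs m (m-upper , m-least) →
        (λ x∈ → let (a , a∈xs , x≡ea) = ∈-map⁻ e x∈ in
                ≡.subst (_⊑ e m) (≡.sym x≡ea) (e-mono (m-upper a∈xs)))
      , (λ V ⊑V J J-upper → ⊣⇒upper (⊣-down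
          (m-least _ ⋁ᶠ-upper)
          (⊣-⋁ᶠ (All.tabulate λ x∈xs → e-upper⇒⊣ (⊑V (∈-map⁺ e x∈xs) J J-upper)))))
    }

  dense : Dense P completion e
  dense U =
      ( below , (λ { (lift (F , _ , ≡.refl)) → κ-closed F })
      , (λ I I-upper F F∈U → I-upper F (into (κ F , lift (F , F∈U , ≡.refl) , κ-self F)))
      , ⋁-least below λ { (lift (F , F∈U , ≡.refl)) → below⇒κ⊑ (∈⇒below {U} F∈U) })
    , ( above , (λ { (lift (I , _ , ≡.refl)) → ω-open I })
      , ⋀-greatest above (λ { (lift (I , I-upper , ≡.refl)) → upper⇒⊑ω I-upper })
      , (λ I I-upper → ω-upper (⋀-lower above (lift (I , I-upper , ≡.refl)))))
    where
    below above : Pred Family 1ℓ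
    below V = Lift _ (∃ λ F → T (U F) × V ≡ κ F)
    above V = Lift _ (∃ λ I → IsUpper U I × V ≡ ω I)

  private
    -- One member of `S` is chosen under each `e a`. The bound is stated for any `V`, so that `V`
    -- can later be the meet of a longer, nonempty list.
    lower-selection : ∀ {S : Pred Family 1ℓ} {xs} → All (λ a → ∃ λ U → S U × U ⊑ e a) xs →
      ∃ λ Us → All S Us × (∀ {V} → (∀ {U} → U ∈ Us → V ⊑ U) → V ⊑ e (⋀ᶠ xs))
    lower-selection []                      =
      [] , [] , λ _ → ⊢⇒⊑e λ F _ → [] , [] , L.refl
    lower-selection {xs = x ∷ xs} ((U , U∈S , U⊑e) ∷ ps) with lower-selection ps
    ... | Us , Us⊆S , bound = U ∷ Us , U∈S ∷ Us⊆S , λ {V} V⊑ → ⊢⇒⊑e λ F F∈V → ⊢-∧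
      (⊑e⇒⊢ (⊑-trans {V} {U} {e x} (V⊑ (here ≡.refl)) U⊑e) F∈V)
      (⊑e⇒⊢ {V} (bound (V⊑ ∘ there)) F∈V)

    upper-selection : ∀ {S : Pred Family 1ℓ} {xs} → All (λ a → ∃ λ U → S U × e a ⊑ U) xs →
      ∃ λ Us → All S Us × (∀ {V} → (∀ {U} → U ∈ Us → U ⊑ V) → e (⋁ᶠ xs) ⊑ V)
    upper-selection []                      =
      [] , [] , λ _ J J-upper → ⊣⇒upper ([] , [] , L.refl)
    upper-selection {xs = x ∷ xs} ((U , U∈S , e⊑U) ∷ ps) with upper-selection ps
    ... | Us , Us⊆S , bound = U ∷ Us , U∈S ∷ Us⊆S , λ {V} ⊑V J J-upper → ⊣⇒upper (⊣-∨
      (e-upper⇒⊣ (⊑-trans {e x} {U} {V} e⊑U (⊑V (here ≡.refl)) J J-upper))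
      (e-upper⇒⊣ (bound {V} (⊑V ∘ there) J J-upper)))

  -- `F` collects the elements above some member of `S`, and `I` those below some member of `T′`. As
  -- these members are closed and open, `⋀ S ⊑ ⋁ T′` gives `κ F ⊑ ω I`, hence one `a` in both the
  -- filter and the ideal. Its derivations use finitely many generators, each owed to a single
  -- member.
  compact : Compact P completion e
  compact S T′ (U₀ , U₀∈S) (V₀ , V₀∈T) S⊆K T⊆O = mk⇔ to from
    where
    F I : Subset
    F a = ⌈ (∃ λ U → S U × U ⊑ e a) ⌉
    I a = ⌈ (∃ λ U → T′ U × e a ⊑ U) ⌉

    κF⊑⋀S : κ F ⊑ ⋀ S
    κF⊑⋀S = ⋀-greatest S λ {U} U∈S → let (A , _ , U⊑ , ⊑U) = S⊆K U∈S in
      ⊑-trans {κ F} {⋀ (image′ A)} {U}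
        (⋀-greatest (image′ A) λ (lift (a , a∈A , p , q)) →
          ⊑-trans {κ F} {e a} (κ⊑e (⊢-gen (into (U , U∈S ,
            ⊑-trans {U} {⋀ (image′ A)} U⊑
              (⋀-lower (image′ A) (lift (a , a∈A , ⊑-refl , ⊑-refl))))))) q)
        ⊑U

    ⋁T⊑ωI : ⋁ T′ ⊑ ω I
    ⋁T⊑ωI = ⋁-least T′ λ {U} U∈T → let (A , _ , U⊑ , ⊑U) = T⊆O U∈T in
      ⊑-trans {U} {⋁ (image′ A)} {ω I}
        U⊑
        (⋁-least (image′ A) λ (lift (a , a∈A , p , q)) →
          ⊑-trans {V = e a} {ω I} p (e⊑ω (⊣-gen (into (U , U∈T ,
            ⊑-trans {V = ⋁ (image′ A)} {U}
              (⋁-upper (image′ A) (lift (a , a∈A , ⊑-refl , ⊑-refl))) ⊑U)))))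

    to : ⋀ S ⊑ ⋁ T′ → ∃₂ λ S₀ T₀ → (∀ {U} → finite S₀ U → S U) × (∀ {U} → finite T₀ U → T′ U) ×
                                  ⋀ (finite S₀) ⊑ ⋁ (finite T₀)
    to ⋀S⊑⋁T with κ⊑ω⇒≬ {F} {I} (⊑-trans {κ F} {⋀ S} {ω I} κF⊑⋀S
                                  (⊑-trans {⋀ S} {⋁ T′} {ω I} ⋀S⊑⋁T ⋁T⊑ωI))
    ... | a , (xs , xs⊆F , ⋀xs≤a) , (ys , ys⊆I , a≤⋁ys)
      with lower-selection {S} (All.map out xs⊆F) | upper-selection {T′} (All.map out ys⊆I)
    ... | Us , Us⊆S , ⊑⋀xs | Vs , Vs⊆T , ⋁ys⊑ =
      -- The given members `U₀` and `V₀` make the lists nonempty, since `xs` or `ys` may be empty.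
      U₀ ∷⁺ Us , V₀ ∷⁺ Vs
      , (λ (lift U∈) → All.lookup (U₀∈S ∷ Us⊆S) U∈)
      , (λ (lift V∈) → All.lookup (V₀∈T ∷ Vs⊆T) V∈)
      , ⊑-trans {⋀ S₀} {e (⋀ᶠ xs)} {⋁ T₀} (⊑⋀xs {⋀ S₀} λ U∈ → ⋀-lower S₀ (lift (there U∈)))
          (⊑-trans {e (⋀ᶠ xs)} {e (⋁ᶠ ys)} {⋁ T₀} (e-mono (L.trans ⋀xs≤a a≤⋁ys))
            (⋁ys⊑ {⋁ T₀} λ V∈ → ⋁-upper T₀ (lift (there V∈))))
      where
      S₀ = finite (U₀ ∷⁺ Us)
      T₀ = finite (V₀ ∷⁺ Vs)

    from : (∃₂ λ S₀ T₀ → (∀ {U} → finite S₀ U → S U) × (∀ {U} → finite T₀ U → T′ U) ×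
                                  ⋀ (finite S₀) ⊑ ⋁ (finite T₀)) → ⋀ S ⊑ ⋁ T′
    from (S₀ , T₀ , S₀⊆S , T₀⊆T , p) =
      ⊑-trans {⋀ S} {⋀ (finite S₀)} {⋁ T′} (⋀-greatest (finite S₀) λ U∈ → ⋀-lower S (S₀⊆S U∈))
        (⊑-trans {⋀ (finite S₀)} {⋁ (finite T₀)} {⋁ T′} p
          (⋁-least (finite T₀) λ V∈ → ⋁-upper T′ (T₀⊆T V∈)))

  isCanonicalExtension : IsCanonicalExtension P completion e
  isCanonicalExtension = record
    { isCompletion = isCompletion ; dense = dense ; compact = compact }

  -- Closed and open elements have the forms `κ F` and `ω I`, and `κ F ⊑ ω I` is witnessed by a
  -- lattice element lying in both the filter and the ideal.
  interpolate : ∀ {U V} → Closed P completion e U → Open P completion e V → U ⊑ V →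
                ∃ λ a → U ⊑ e a × e a ⊑ V
  interpolate {U} {V} (A , _ , U⊑ , ⊑U) (B , _ , V⊑ , ⊑V) U⊑V =
    let F = comprehension A
        I = comprehension B
        U⊑κ = ⊑-trans {U} {⋀ (image′ A)} {κ F} U⊑ (proj₂ (⋀-image A))
        κ⊑U = ⊑-trans {κ F} {⋀ (image′ A)} {U} (proj₁ (⋀-image A)) ⊑U
        V⊑ω = ⊑-trans {V} {⋁ (image′ B)} {ω I} V⊑ (proj₂ (⋁-image B))
        ω⊑V = ⊑-trans {ω I} {⋁ (image′ B)} {V} (proj₁ (⋁-image B)) ⊑V
        (a , F⊢a , a⊣I) = κ⊑ω⇒≬ (⊑-trans {κ F} {U} {ω I} κ⊑U (⊑-trans {U} {V} {ω I} U⊑V V⊑ω))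
    in a , ⊑-trans {U} {κ F} {e a} U⊑κ (κ⊑e F⊢a) , ⊑-trans {e a} {ω I} {V} (e⊑ω a⊣I) ω⊑V

-- The canonical extension of a double-Heyting algebra: embedding, order and limits of `box`.

module Extension
  {A : Algebra} (dh : IsDoubleHeyting A)
  (C : CompleteLattice) (e : ∣ A ∣ → CompleteLattice.Carrier C)
  (ce : IsCanonicalExtension (IsDoubleHeyting.poset dh) C e)
  (interpolate : ∀ {x y} →
    Closed (IsDoubleHeyting.poset dh) C e x → Open (IsDoubleHeyting.poset dh) C e y →
    CompleteLattice._≤_ C x y →
    ∃ λ a → CompleteLattice._≤_ C x (e a) × CompleteLattice._≤_ C (e a) y)
  where

  private
    P = IsDoubleHeyting.poset dh
    module C = CompleteLattice C
    module D = DoubleHeyting dh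
  open IsCanonicalExtension ce
  open IsCompletion isCompletion
  open IsOrderMonomorphism isOrderEmbedding
    using () renaming (cong to e-cong; mono to e-mono; cancel to e-cancel)

  M : Algebra
  M = canonicalAlgebra A dh C e

  e-closed : ∀ a → Closed P C e (e a)
  e-closed a = (_≡ a) , (a , ≡.refl) , C.antisym
    (proj₂ (C.⋀-glb _) _ λ { (lift (_ , ≡.refl , x≈)) → C.reflexive (C.Eq.sym x≈) })
    (proj₁ (C.⋀-glb _) (lift (a , ≡.refl , C.Eq.refl)))

  e-open : ∀ a → Open P C e (e a)
  e-open a = (_≡ a) , (a , ≡.refl) , C.antisym
    (proj₁ (C.⋁-lub _) (lift (a , ≡.refl , C.Eq.refl)))
    (proj₂ (C.⋁-lub _) _ λ { (lift (_ , ≡.refl , x≈)) → C.reflexive x≈ })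

  module _ {n : ℕ} {f : Vector ∣ A ∣ n → ∣ A ∣}
           (f-cong : ∀ {v w} → (∀ i → v i D.≈ w i) → f v D.≈ f w)
           {v : Vector ∣ A ∣ n} {x : Vector C.Carrier n}
           (x≈ev : ∀ i → x i C.≈ e (v i)) where

    private
      point : Interval P C e f x (e ∘ v) (e ∘ v)
      point = (λ i → e-closed (v i)) , (λ i → e-open (v i)) ,
        (λ i → C.reflexive (C.Eq.sym (x≈ev i))) , (λ i → C.reflexive (x≈ev i))

      on-point : ∀ {y} → values P C e f (e ∘ v) (e ∘ v) y → e (f v) C.≈ y
      on-point (lift (a , v≤a , a≤v , y≈)) = C.Eq.trans
        (e-cong (f-cong λ i → D.antisym (e-cancel (v≤a i)) (e-cancel (a≤v i)))) (C.Eq.sym y≈)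

      in-values : ∀ {p q} → Interval P C e f x p q → values P C e f p q (e (f v))
      in-values (_ , _ , p≤x , x≤q) = lift (v ,
        (λ i → C.≤-respʳ-≈ (x≈ev i) (p≤x i)) , (λ i → C.≤-respˡ-≈ (x≈ev i) (x≤q i)) , C.Eq.refl)

    -- Images of `e` are both closed and open, so the degenerate interval at `e ∘ v` is admissible
    -- and yields `e (f v)`; every other interval around `x` contains `v`.
    σ-ext-extends : e (f v) C.≈ σ-ext P C e f x
    σ-ext-extends = C.antisym
      (C.trans (proj₂ (C.⋀-glb _) _ λ y∈ → C.reflexive (on-point y∈))
        (proj₁ (C.⋁-lub _) (_ , _ , point , C.Eq.refl)))
      (proj₂ (C.⋁-lub _) _ λ (_ , _ , I , y≈) → C.trans (C.reflexive y≈)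
        (proj₁ (C.⋀-glb _) (in-values I)))

    π-ext-extends : e (f v) C.≈ π-ext P C e f x
    π-ext-extends = C.antisym
      (proj₂ (C.⋀-glb _) _ λ (_ , _ , I , y≈) → C.trans
        (proj₁ (C.⋁-lub _) (in-values I)) (C.reflexive (C.Eq.sym y≈)))
      (C.trans (proj₁ (C.⋀-glb _) (_ , _ , point , C.Eq.refl))
        (proj₂ (C.⋁-lub _) _ λ y∈ → C.reflexive (C.Eq.sym (on-point y∈))))

  e-isHomomorphism : IsHomomorphism A M e
  e-isHomomorphism = record
    { ≈-cong = e-cong ; ⊥-homo = C.Eq.refl ; ⊤-homo = C.Eq.refl ; homo = homo }
    where
    pair : ∀ x y → ∀ i → (e x ∷ᵛ e y ∷ᵛ []ᵛ) i C.≈ e ((x ∷ᵛ y ∷ᵛ []ᵛ) i)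
    pair x y zero       = C.Eq.refl
    pair x y (suc zero) = C.Eq.refl

    f-cong : ∀ o {v w : Vector ∣ A ∣ 2} → (∀ i → v i D.≈ w i) →
             Algebra.op A o (v zero) (v (suc zero)) D.≈ Algebra.op A o (w zero) (w (suc zero))
    f-cong o v≈w = Algebra.op-cong A o (v≈w zero) (v≈w (suc zero))

    homo : ∀ o x y → e (Algebra.op A o x y) C.≈ Algebra.op M o (e x) (e y)
    homo meet x y = σ-ext-extends (f-cong meet) (pair x y)
    homo join x y = σ-ext-extends (f-cong join) (pair x y)
    homo imp  x y = π-ext-extends (f-cong imp) (pair x y)
    homo sub  x y = σ-ext-extends (f-cong sub) (pair x y)

  private
    infixr 7 _⊓_
    _⊓_ = Algebra._∧_ M

  e-∧-greatest : ∀ {z a b} → z C.≤ e a → z C.≤ e b → z C.≤ e (a D.∧ b)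
  e-∧-greatest {z} {a} {b} z≤a z≤b = proj₂ (preservesMeets (a ∷ b ∷ []) (a D.∧ b)
    ( (λ { (here ≡.refl) → D.x∧y≤x _ _ ; (there (here ≡.refl)) → D.x∧y≤y _ _ })
    , λ y y≤ → D.∧-greatest (y≤ (here ≡.refl)) (y≤ (there (here ≡.refl))))) z
    λ { (here ≡.refl) → z≤a ; (there (here ≡.refl)) → z≤b }

  e-𝟙-maximum : ∀ z → z C.≤ e D.𝟙
  e-𝟙-maximum z = proj₂ (preservesMeets [] D.𝟙 ((λ ()) , λ y _ → D.maximum y)) z λ ()

  -- By density it suffices to treat the closed `k` below `z`; for these the interval from `k` to
  -- `e 𝟙` in both coordinates already contributes at least `k` to the join.
  ⊓-greatest : ∀ {x y z} → z C.≤ x → z C.≤ y → z C.≤ x ⊓ y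
  ⊓-greatest {x} {y} {z} z≤x z≤y with proj₁ (dense z)
  ... | S , S⊆K , z≈⋁S = C.trans (C.reflexive z≈⋁S) (proj₂ (C.⋁-lub S) _ λ {k} k∈S →
    let k≤z = C.trans (proj₁ (C.⋁-lub S) k∈S) (C.reflexive (C.Eq.sym z≈⋁S)) in
    C.trans
      (proj₂ (C.⋀-glb _) _ λ (lift (a , k≤a , _ , y≈)) →
        C.≤-respʳ-≈ (C.Eq.sym y≈) (e-∧-greatest (k≤a zero) (k≤a (suc zero))))
      (proj₁ (C.⋁-lub _) ((λ _ → k) , (λ _ → e D.𝟙) ,
        ((λ _ → S⊆K k∈S) , (λ _ → e-open D.𝟙) ,
         (λ { zero → C.trans k≤z z≤x ; (suc zero) → C.trans k≤z z≤y }) ,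
         (λ _ → e-𝟙-maximum _)) , C.Eq.refl)))

  -- Each joinand lies below `p i`: as `p i` is a meet of elements `e s`, it suffices to find, for
  -- each `s`, arguments in the interval whose meet is below `s`.
  ⊓-lower : ∀ {x y} → x ⊓ y C.≤ x × x ⊓ y C.≤ y
  ⊓-lower {x} {y} =
      proj₂ (C.⋁-lub _) _ (λ (p , q , I , w≈) → C.trans (C.reflexive w≈)
        (C.trans (bound p q I zero) (proj₁ (proj₂ (proj₂ I)) zero)))
    , proj₂ (C.⋁-lub _) _ (λ (p , q , I , w≈) → C.trans (C.reflexive w≈)
        (C.trans (bound p q I (suc zero)) (proj₁ (proj₂ (proj₂ I)) (suc zero))))
    where
    ∧′ : Vector ∣ A ∣ 2 → ∣ A ∣
    ∧′ v = v zero D.∧ v (suc zero)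

    ∧′-lower : ∀ v i → ∧′ v D.≤ v i
    ∧′-lower v zero       = D.x∧y≤x _ _
    ∧′-lower v (suc zero) = D.x∧y≤y _ _

    bound : ∀ p q → Interval P C e ∧′ (x ∷ᵛ y ∷ᵛ []ᵛ) p q → ∀ i →
            C.⋀ (values P C e ∧′ p q) C.≤ p i
    bound p q (p∈K , q∈O , p≤x , x≤q) i with p∈K i
    ... | S , _ , p≈⋀S = C.≤-respʳ-≈ (C.Eq.sym p≈⋀S) (proj₂ (C.⋀-glb _) _ ⋀≤)
      where
      between : ∀ j → ∃ λ a → p j C.≤ e a × e a C.≤ q j
      between j = interpolate (p∈K j) (q∈O j) (C.trans (p≤x j) (x≤q j))

      -- Interpolation supplies an argument between `p j` and `q j`; at coordinate `i`, meeting it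
      -- with `s` keeps it above `p i` and brings it below `s`.
      below : ∀ s → p i C.≤ e s → ∀ j → ∃ λ a → p j C.≤ e a × e a C.≤ q j × (j ≡ i → a D.≤ s)
      below s p≤es j with between j | j ≟ i
      ... | a , p≤ea , ea≤q | yes ≡.refl =
        s D.∧ a , e-∧-greatest p≤es p≤ea , C.trans (e-mono (D.x∧y≤y _ _)) ea≤q , λ _ → D.x∧y≤x _ _
      ... | a , p≤ea , ea≤q | no j≢i = a , p≤ea , ea≤q , λ j≡i → contradiction j≡i j≢i

      ⋀≤ : ∀ {z} → image P C e S z → C.⋀ (values P C e ∧′ p q) C.≤ z
      ⋀≤ (lift (s , s∈S , z≈es)) = C.≤-respʳ-≈ (C.Eq.sym z≈es) (C.trans
        (proj₁ (C.⋀-glb _) (lift (v , (λ j → proj₁ (proj₂ (b j))) ,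
          (λ j → proj₁ (proj₂ (proj₂ (b j)))) , C.Eq.refl)))
        (e-mono (D.trans (∧′-lower v i) (proj₂ (proj₂ (proj₂ (b i))) ≡.refl))))
        where
        b = below s (C.trans (C.reflexive p≈⋀S) (proj₁ (C.⋀-glb _) (lift (s , s∈S , C.Eq.refl))))
        v : Vector ∣ A ∣ 2
        v j = proj₁ (b j)

  -- The order of `M` is defined from its own meet; its agreement with the order of `C` makes the
  -- infima of `C` usable inside the double-Heyting algebra `M`.
  ≤ᴹ⇒≤ : ∀ {x y} → Algebra._≤_ M x y → x C.≤ y
  ≤ᴹ⇒≤ x⊓y≈x = C.trans (C.reflexive (C.Eq.sym x⊓y≈x)) (proj₂ ⊓-lower)

  ≤⇒≤ᴹ : ∀ {x y} → x C.≤ y → Algebra._≤_ M x y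
  ≤⇒≤ᴹ x≤y = C.antisym (proj₁ ⊓-lower) (⊓-greatest C.refl x≤y)

  module _ (mdh : IsDoubleHeyting M) (x : C.Carrier) where
    private
      module M = DoubleHeyting mdh

      iterates : Pred C.Carrier 1ℓ
      iterates y = Lift 1ℓ (∃ λ k → y ≡ box^ M k x)

    box-limit : C.Carrier
    box-limit = C.⋀ iterates

    box-limit-lower : ∀ k → box-limit M.≤ box^ M k x
    box-limit-lower k = ≤⇒≤ᴹ (proj₁ (C.⋀-glb iterates) (lift (k , ≡.refl)))

    box-limit-greatest : ∀ {z} → (∀ k → z M.≤ box^ M k x) → z M.≤ box-limit
    box-limit-greatest z≤ = ≤⇒≤ᴹ (proj₂ (C.⋀-glb iterates) _
      λ { (lift (k , ≡.refl)) → ≤ᴹ⇒≤ (z≤ k) })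

    -- Writing xₖ = box^ k x and y for their meet, ∼xₖ ≤ ¬¬∼xₖ = ¬xₖ₊₁ ≤ ¬y, so
    -- ⊤ ≤ ¬y ∨ xₖ for every k; by dual residuation ⊤ ≤ ¬y ∨ y.
    box-limit-complemented : M.Complemented box-limit
    box-limit-complemented = M.trans (M.transpose-∨ (box-limit-greatest λ k → M.transpose--
      (M.trans (M.x∨∼x _) (M.trans M.∨-swap (M.∨-mono
        (M.swap-transpose-⇨ (M.trans (M.∧-mono (box-limit-lower (suc k)) M.refl) (M.¬x∧x _)))
        M.refl)))))
      M.∨-swap

    box-limit-fixed : box-limit M.≤ box M box-limit
    box-limit-fixed = M.complemented⇒≤box box-limit-complemented

-- Finite presentations in chosen generators.

infixl 20 _[_]

_[_] : ∀ {X Y : Set} → Term X → (X → Term Y) → Term Y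
s [ σ ] = eval (TermAlgebra _) σ s

Satisfies : ∀ (A : Algebra) {X : Set} → (X → ∣ A ∣) → Pred (Term X × Term X) 0ℓ
Satisfies A ρ (s , t) = Algebra._≈_ A (eval A ρ s) (eval A ρ t)

-- Finite presentability does not depend on the choice of a finite generating family.
presentation-in-generators :
  ∀ {E S} → FinitelyPresented E S → ∀ {m} (g : Fin m → ∣ S ∣) →
  (∀ u → ∃ λ p → Algebra._≈_ S (eval S g p) u) →
  ∃ λ rs → All (Satisfies S g) rs ×
           (∀ B → Mod E B → (ρ : Fin m → ∣ B ∣) → All (Satisfies B ρ) rs →
            ∀ r → Satisfies S g r → Satisfies B ρ r)
presentation-in-generators {E} {S} (n , rs , h , hom , inj , surj) {m} g generates =
  relations ,
  ++⁺ (map⁺ (All.tabulate rs-hold)) (map⁺ (All.tabulate λ {j} _ → gens-hold j)) ,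
  universal
  where
  F : Algebra
  F = Free E (Fin n) /Cg (λ s t → (s , t) ∈ rs)

  module F = Setoid (setoid F)

  p : Fin n → Term (Fin m)
  p i = proj₁ (generates (proj₁ (surj (var i))))

  -- The elements of `F` are terms, so `h (g j)` is itself an expression of `g j` in the old
  -- generators.
  q : Fin m → Term (Fin n)
  q j = h (g j)

  h-eval : ∀ s → h (eval S g s) F.≈ s [ q ]
  h-eval s = F.trans (eval-homo S hom g s) (F.reflexive (eval-presented _ q s))

  p-inverse : ∀ s → h (eval S g (s [ p ])) F.≈ s
  p-inverse s = F.trans (h-eval (s [ p ]))
    (F.trans (F.reflexive (≡.sym (eval-presented _ q (s [ p ]))))
    (F.trans (eval-substitute F q p s) (F.trans (eval-cong F on-var s)
      (F.reflexive (≡.trans (eval-presented _ var s) (eval-var s))))))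
    where
    on-var : ∀ i → eval F q (p i) F.≈ var i
    on-var i = F.trans (F.reflexive (eval-presented _ q (p i))) (F.trans (F.sym (h-eval (p i)))
      (proj₂ (surj (var i)) (proj₂ (generates (proj₁ (surj (var i)))))))

  relations : List (Term (Fin m) × Term (Fin m))
  -- The old relations translated by `p`, and for each new generator the relation that translating
  -- it back and forth returns it.
  relations = map (λ (s , t) → s [ p ] , t [ p ]) rs ++ map (λ j → q j [ p ] , var j) (allFin m)

  rs-hold : ∀ {r} → r ∈ rs → Satisfies S g (proj₁ r [ p ] , proj₂ r [ p ])
  rs-hold {s , t} r∈rs = inj (F.trans (p-inverse s) (F.trans (base r∈rs) (F.sym (p-inverse t))))

  gens-hold : ∀ j → Satisfies S g (q j [ p ] , var j)
  gens-hold j = inj (p-inverse (q j))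

  universal : ∀ B → Mod E B → (ρ : Fin m → ∣ B ∣) → All (Satisfies B ρ) relations →
              ∀ r → Satisfies S g r → Satisfies B ρ r
  universal B B∈E ρ sat (s , t) s≈t =
    B.trans (B.sym (retract s)) (B.trans (φ-sound (F.trans (F.sym (h-eval s))
      (F.trans (IsHomomorphism.≈-cong hom s≈t) (h-eval t)))) (retract t))
    where
    module B = Setoid (setoid B)

    φ : Fin n → ∣ B ∣
    φ i = eval B ρ (p i)

    φ-sound : ∀ {u v} → u F.≈ v → eval B φ u B.≈ eval B φ v
    φ-sound = presented-sound B B∈E φ λ {u} {v} r∈rs →
      B.trans (B.sym (eval-substitute B ρ p u))
        (B.trans (All.lookup sat (∈-++⁺ˡ (∈-map⁺ _ r∈rs))) (eval-substitute B ρ p v))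

    -- The second group of relations recovers `ρ` from `φ`.
    retract : ∀ s → eval B φ (s [ q ]) B.≈ eval B ρ s
    retract s = B.trans (eval-substitute B φ q s) (eval-cong B (λ j →
      B.trans (B.sym (eval-substitute B ρ p (q j)))
        (All.lookup sat (∈-++⁺ʳ (map _ rs) (∈-map⁺ _ (∈-allFin j))))) s)

Generated-term : ∀ A {m} (g : Fin m → ∣ A ∣) {u} → Generated A g u → ∃ λ p → eval A g p ≡ u
Generated-term A g (gen i)     = var i , ≡.refl
Generated-term A g gen-⊥       = ⊥ , ≡.refl
Generated-term A g gen-⊤       = ⊤ , ≡.refl
Generated-term A g (gen-∙ o a b) with Generated-term A g a | Generated-term A g b
... | s , ≡.refl | t , ≡.refl = op o s t , ≡.refl

module _ (A : Algebra) {m : ℕ} (g : Fin m → ∣ A ∣) where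
  open Setoid (setoid A)

  Sg-generators : Fin m → ∣ Sg A g ∣
  Sg-generators i = g i , gen i

  eval-Sg : ∀ s → proj₁ (eval (Sg A g) Sg-generators s) ≈ eval A g s
  eval-Sg = eval-homo (Sg A g) {A} {proj₁} record
    { ≈-cong = λ p → p ; ⊥-homo = refl ; ⊤-homo = refl ; homo = λ _ _ _ → refl } Sg-generators

  Sg-generated : ∀ u → ∃ λ p → Algebra._≈_ (Sg A g) (eval (Sg A g) Sg-generators p) u
  Sg-generated (u , u∈) with Generated-term A g u∈
  ... | p , ≡.refl = p , eval-Sg p

-- Coherence bounds the iterates of `box`.

module Stabilization
  (em : ∀ {ℓ : Level} → ExcludedMiddle ℓ) (E : Equations) (dhv : IsDoubleHeytingVariety E)
  (cce : ClosedUnderCanonicalExtensions E dhv) (coherent : Coherent E) where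

  x z : Term (Fin 2)
  x = var zero
  z = var (suc zero)

  z≤box^x : ℕ → Term (Fin 2) × Term (Fin 2)
  z≤box^x k = op meet z (box^ (TermAlgebra _) k x) , z

  Below : ℕ → (B : Algebra) → (Fin 2 → ∣ B ∣) → Set
  Below k B ρ = Algebra._≤_ B (ρ (suc zero)) (box^ B k (ρ zero))

  below⇒satisfies : ∀ k B ρ → Below k B ρ → Satisfies B ρ (z≤box^x k)
  below⇒satisfies k B ρ p rewrite eval-box^ B ρ k x = p

  satisfies⇒below : ∀ k B ρ → Satisfies B ρ (z≤box^x k) → Below k B ρ
  satisfies⇒below k B ρ p rewrite eval-box^ B ρ k x = p

  Entails : ℕ → Term (Fin 2) × Term (Fin 2) → Set₁
  Entails k r = ∀ B → Mod E B → ∀ ρ → Below k B ρ → Satisfies B ρ r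

  Entails-mono : ∀ {j k} r → j ≤ᴺ k → Entails j r → Entails k r
  Entails-mono r j≤k j⊨r B B∈E ρ below = j⊨r B B∈E ρ (trans below (box^-antitone j≤k _))
    where open DoubleHeyting (dhv B B∈E)

  chain : Rel (Term (Fin 2)) 0ℓ
  chain s t = ∃ λ k → (s , t) ≡ z≤box^x k

  -- A derivation uses finitely many relations of the chain, and since they grow stronger with the
  -- exponent, the largest one used suffices.
  chain-finitary : ∀ {s t} → Cg (Free E (Fin 2)) chain s t → ∃ λ k → Entails k (s , t)
  chain-finitary (base (k , ≡.refl)) = k , λ B _ ρ below → below⇒satisfies k B ρ below
  chain-finitary (≈⇒Cg s≈t)     = 0 , λ B B∈E ρ _ → Free-sound B B∈E ρ s≈t
  chain-finitary (Cg-sym p) with chain-finitary p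
  ... | k , s≈t = k , λ B B∈E ρ below → Setoid.sym (setoid B) (s≈t B B∈E ρ below)
  chain-finitary (Cg-trans {s} {t} {u} p q) with chain-finitary p | chain-finitary q
  ... | j , s≈t | k , t≈u = j ⊔ k , λ B B∈E ρ below → Setoid.trans (setoid B)
    (Entails-mono (s , t) (m≤m⊔n j k) s≈t B B∈E ρ below)
    (Entails-mono (t , u) (m≤n⊔m j k) t≈u B B∈E ρ below)
  chain-finitary (Cg-cong o {s} {t} {u} {v} p q) with chain-finitary p | chain-finitary q
  ... | j , s≈t | k , u≈v = j ⊔ k , λ B B∈E ρ below → Algebra.op-cong B o
    (Entails-mono (s , t) (m≤m⊔n j k) s≈t B B∈E ρ below)
    (Entails-mono (u , v) (m≤n⊔m j k) u≈v B B∈E ρ below)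

  Entails-All : ∀ {rs} → All (λ r → ∃ λ k → Entails k r) rs → ∃ λ k → All (Entails k) rs
  Entails-All []             = 0 , []
  Entails-All {r ∷ _} ((j , p) ∷ ps) with Entails-All ps
  ... | k , qs = j ⊔ k ,
    Entails-mono r (m≤m⊔n j k) p ∷ All.map (λ {r} → Entails-mono r (m≤n⊔m j k)) qs

  x′ z′ y′ : Term (Fin 3)
  x′ = var zero
  z′ = var (suc zero)
  y′ = var (suc (suc zero))

  rs : List (Term (Fin 3) × Term (Fin 3))
  rs = (op meet z′ y′ , z′) ∷ (op meet y′ x′ , y′) ∷
       (op meet y′ (box (TermAlgebra _) y′) , y′) ∷ []

  fixpoint-algebra : Algebra
  fixpoint-algebra = Free E (Fin 3) /Cg (λ s t → (s , t) ∈ rs)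

  fixpoint-algebra∈Mod : Mod E fixpoint-algebra
  fixpoint-algebra∈Mod = presented-∈Mod _

  -- Coherence is applied to the subalgebra generated by these two elements, from which the
  -- generator `y′` is left out.
  g : Fin 2 → ∣ fixpoint-algebra ∣
  g zero       = x′
  g (suc zero) = z′

  g-below : ∀ k → Below k fixpoint-algebra g
  g-below k = trans (base (here ≡.refl)) (y≤box^x k)
    where
    open DoubleHeyting (dhv fixpoint-algebra fixpoint-algebra∈Mod)

    y≤box^x : ∀ k → y′ ≤ box^ fixpoint-algebra k x′
    y≤box^x zero    = base (there (here ≡.refl))
    y≤box^x (suc k) = trans (base (there (there (here ≡.refl)))) (box-mono (y≤box^x k))

  chain-algebra : Algebra
  chain-algebra = Free E (Fin 2) /Cg chain

  chain-algebra∈Mod : Mod E chain-algebra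
  chain-algebra∈Mod = presented-∈Mod _

  -- The chain algebra embeds into its canonical extension, where the meet of the
  -- box^ k x interprets the third generator y of the fixpoint algebra.
  conservative : ∀ r → Satisfies fixpoint-algebra g r →
                 Algebra._≈_ chain-algebra (proj₁ r) (proj₂ r)
  conservative (s , t) s≈t = e-injective
    (M.trans (M.sym (extends s)) (M.trans (presented-sound M M∈E ρ rs-hold s≈t) (extends t)))
    where
    dh = dhv chain-algebra chain-algebra∈Mod
    open CanonicalExtension em (DoubleHeyting.boundedLattice dh)
    open Extension dh completion e isCanonicalExtension interpolate
    open IsOrderMonomorphism (IsCompletion.isOrderEmbedding isCompletion)
      using () renaming (injective to e-injective)
    module M = Setoid (setoid M)

    M∈E : Mod E M
    M∈E = cce chain-algebra chain-algebra∈Mod completion e isCanonicalExtension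

    mdh : IsDoubleHeyting M
    mdh = dhv M M∈E

    e-eval : ∀ s → eval M (e ∘ var) s M.≈ e s
    e-eval s = M.trans (M.sym (eval-homo chain-algebra e-isHomomorphism var s))
      (M.reflexive (≡.cong e (≡.trans (eval-presented _ var s) (eval-var s))))

    below : ∀ k → Below k M (e ∘ var)
    below k = satisfies⇒below k M (e ∘ var) (M.trans (e-eval (proj₁ (z≤box^x k)))
      (IsHomomorphism.≈-cong e-isHomomorphism (base (k , ≡.refl))))

    ρ : Fin 3 → ∣ M ∣
    ρ zero             = e x
    ρ (suc zero)       = e z
    ρ (suc (suc zero)) = box-limit mdh (e x)

    rs-hold : ∀ {s t} → (s , t) ∈ rs → eval M ρ s M.≈ eval M ρ t
    rs-hold (here ≡.refl)                 = box-limit-greatest mdh (e x) below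
    rs-hold (there (here ≡.refl))         = box-limit-lower mdh (e x) 0
    rs-hold (there (there (here ≡.refl))) = box-limit-fixed mdh (e x)

    ρ∘g : ∀ i → eval M ρ (g i) M.≈ e (var i)
    ρ∘g zero       = M.refl
    ρ∘g (suc zero) = M.refl

    extends : ∀ s → eval M ρ (eval fixpoint-algebra g s) M.≈ e s
    extends s = M.trans (M.reflexive (≡.cong (eval M ρ) (eval-presented _ g s)))
      (M.trans (eval-substitute M ρ g s) (M.trans (eval-cong M ρ∘g s) (e-eval s)))

  box^-stabilizes : ∃ λ n → ∀ B → Mod E B → ∀ a → Algebra._≤_ B (box^ B n a) (box^ B (suc n) a)
  box^-stabilizes with presentation-in-generators
      -- The identity map serves as the presentation of the fixpoint algebra.
      (coherent fixpoint-algebra fixpoint-algebra∈Mod (3 , rs , ≅-refl _) 2 g)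
      (Sg-generators fixpoint-algebra g) (Sg-generated fixpoint-algebra g)
  ... | Π , Π-holds , Π-entails with Entails-All (All.map (λ {r} → entailed r) Π-holds)
    where
    entailed : ∀ r → Satisfies (Sg fixpoint-algebra g) (Sg-generators fixpoint-algebra g) r →
               ∃ λ k → Entails k r
    entailed (s , t) s≈t = chain-finitary (conservative (s , t)
      (Cg-trans (Cg-sym (eval-Sg fixpoint-algebra g s))
        (Cg-trans s≈t (eval-Sg fixpoint-algebra g t))))
  ... | n , n⊨Π = n , λ B B∈E a →
    let open DoubleHeyting (dhv B B∈E)
        -- With `z` interpreted as `box^ B n a`, the premise `Below n` is reflexivity. The relation
        -- `r` is one step further and holds in the subalgebra because there `z` lies below `y′`.
        ρ = a ∷ᵛ box^ B n a ∷ᵛ []ᵛ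
        r = z≤box^x (suc n)
    in satisfies⇒below (suc n) B ρ (Π-entails B B∈E ρ (All.map (λ n⊨r → n⊨r B B∈E ρ refl) n⊨Π) r
      (Cg-trans (eval-Sg fixpoint-algebra g (proj₁ r))
        (Cg-trans (below⇒satisfies (suc n) fixpoint-algebra g (g-below (suc n)))
          (Cg-sym (eval-Sg fixpoint-algebra g (proj₂ r))))))

-- The discriminator term and quotients by ultrafilters of complemented elements.

iff : (A : Algebra) → ∣ A ∣ → ∣ A ∣ → ∣ A ∣
iff A a b = (a A.⇨ b) A.∧ (b A.⇨ a)
  where module A = Algebra A

switch : (A : Algebra) → ∣ A ∣ → ∣ A ∣ → ∣ A ∣ → ∣ A ∣
switch A δ a c = (δ A.∧ c) A.∨ ((δ A.⇨ A.⊥) A.∧ a)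
  where module A = Algebra A

discriminator : (A : Algebra) → ℕ → ∣ A ∣ → ∣ A ∣ → ∣ A ∣ → ∣ A ∣
discriminator A n a b c = switch A (box^ A n (iff A a b)) a c

eval-discriminator : ∀ A {X : Set} (ρ : X → ∣ A ∣) n s t u →
  eval A ρ (discriminator (TermAlgebra X) n s t u) ≡
  discriminator A n (eval A ρ s) (eval A ρ t) (eval A ρ u)
eval-discriminator A ρ n s t u =
  ≡.cong (λ δ → switch A δ (eval A ρ s) (eval A ρ u)) (eval-box^ A ρ n (iff (TermAlgebra _) s t))

module _ {A : Algebra} (dh : IsDoubleHeyting A) where
  open DoubleHeyting dh

  iff-intro : ∀ {b x y} → b ∧ x ≤ y → b ∧ y ≤ x → b ≤ iff A x y
  iff-intro p q = ∧-greatest (transpose-⇨ p) (transpose-⇨ q)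

  iff-elim : ∀ {x y} → 𝟙 ≤ iff A x y → x ≈ y
  iff-elim p = antisym
    (trans (∧-greatest (maximum _) refl) (transpose-∧ (trans p (x∧y≤x _ _))))
    (trans (∧-greatest (maximum _) refl) (transpose-∧ (trans p (x∧y≤y _ _))))

  𝟙-complemented : Complemented 𝟙
  𝟙-complemented = x≤x∨y _ _

  switch-𝟙 : ∀ {δ a c} → 𝟙 ≤ δ → switch A δ a c ≈ c
  switch-𝟙 𝟙≤δ = antisym
    (∨-least (x∧y≤y _ _) (trans (x∧y≤x _ _)
      (trans (∧-greatest refl (trans (maximum _) 𝟙≤δ)) (trans (¬x∧x _) (minimum _)))))
    (trans (∧-greatest (trans (maximum _) 𝟙≤δ) refl) (x≤x∨y _ _))

  switch-𝟘 : ∀ {δ a c} → δ ≤ 𝟘 → switch A δ a c ≈ a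
  switch-𝟘 δ≤𝟘 = antisym
    (∨-least (trans (x∧y≤x _ _) (trans δ≤𝟘 (minimum _))) (x∧y≤y _ _))
    (trans (∧-greatest (transpose-⇨ (trans (x∧y≤y _ _) δ≤𝟘)) refl) (y≤x∨y _ _))

  discriminator-≈ : ∀ n a c → discriminator A n a a c ≈ c
  discriminator-≈ n a c = switch-𝟙
    (complemented⇒≤box^ 𝟙-complemented (iff-intro (x∧y≤y _ _) (x∧y≤y _ _)) n)

  module _ {b : ∣ A ∣} (b-compl : Complemented b) where

    -- Used in both directions, this makes agreement below `b` a congruence, the one that collapses
    -- `b` to `𝟙`. Complementedness enters at `sub`.
    relative-cong : ∀ o {x y u v} → b ∧ x ≤ y → b ∧ y ≤ x → b ∧ u ≤ v → b ∧ v ≤ u →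
                    b ∧ Algebra.op A o x u ≤ Algebra.op A o y v
    relative-cong meet p _ q _ = ∧-greatest
      (trans (∧-mono refl (x∧y≤x _ _)) p) (trans (∧-mono refl (x∧y≤y _ _)) q)
    relative-cong join p _ q _ = trans (∧-distribˡ-∨-≤ _ _ _) (∨-mono p q)
    relative-cong imp _ p q _ = transpose-⇨ (trans
      (∧-greatest (trans (x∧y≤x _ _) (x∧y≤x _ _))
        (trans (∧-greatest (trans (x∧y≤x _ _) (x∧y≤y _ _))
          (trans (∧-mono (x∧y≤x _ _) refl) p)) ⇨-eval)) q)
    -- After both residuations the goal is `x ≤ u ∨ (b ⇨ (y - v))`: on `b` it comes from
    -- `y ≤ v ∨ (y - v)`, and `¬ b` lies below `b ⇨ (y - v)` outright.
    relative-cong sub p _ _ q = trans ∧-swap (transpose-∧ (transpose-- (by-cases b-compl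
      (trans (∧-greatest (x∧y≤x _ _) (trans p (transpose-∨ refl)))
        (trans (∧-distribˡ-∨-≤ _ _ _) (∨-mono q (trans (x∧y≤y _ _) y≤x⇨y))))
      (trans (x∧y≤x _ _) (trans (⇨ʳ-covariant (minimum _)) (y≤x∨y _ _))))))

-- An ultrafilter of the complemented elements containing c, generated by a descending
-- sequence; each stage either falls below box^ n a or becomes disjoint from it.
module Ultraquotient
  (em : ∀ {ℓ : Level} → ExcludedMiddle ℓ) {E : Equations} (dhv : IsDoubleHeytingVariety E)
  (n : ℕ) (stable : ∀ B → Mod E B → ∀ a → Algebra._≤_ B (box^ B n a) (box^ B (suc n) a))
  (A : Algebra) (A∈E : Mod E A)
  (level : ℕ → List ∣ A ∣) (exhaustive : ∀ a → ∃ λ k → a ∈ level k)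
  (c : ∣ A ∣) (c-compl : DoubleHeyting.Complemented (dhv A A∈E) c)
  (c≰𝟘 : Nullary.¬ (Algebra._≤_ A c (Algebra.⊥ A))) where

  open DoubleHeyting (dhv A A∈E)

  box^-complemented : ∀ a → Complemented (box^ A n a)
  box^-complemented a = ≤box⇒complemented (stable A A∈E a)

  Stage : Set
  Stage = ∃ λ b → Complemented b × Nullary.¬ (b ≤ 𝟘)

  refine : ∣ A ∣ → Stage → Stage
  refine a (b , b-compl , b≰𝟘) with em {P = b ∧ box^ A n a ≤ 𝟘}
  ... | yes _      = b , b-compl , b≰𝟘
  ... | no  b∧a≰𝟘 = b ∧ box^ A n a , ∧-complemented b-compl (box^-complemented a) , b∧a≰𝟘

  refine-≤ : ∀ a s → proj₁ (refine a s) ≤ proj₁ s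
  refine-≤ a (b , _) with em {P = b ∧ box^ A n a ≤ 𝟘}
  ... | yes _ = refl
  ... | no  _ = x∧y≤x _ _

  Decides : ∣ A ∣ → ∣ A ∣ → Set
  Decides b a = b ≤ box^ A n a ⊎ b ∧ box^ A n a ≤ 𝟘

  refine-decides : ∀ a s → Decides (proj₁ (refine a s)) a
  refine-decides a (b , _) with em {P = b ∧ box^ A n a ≤ 𝟘}
  ... | yes b∧a≤𝟘 = inj₂ b∧a≤𝟘
  ... | no  _      = inj₁ (x∧y≤y _ _)

  refine-all : List ∣ A ∣ → Stage → Stage
  refine-all as s = foldr refine s as

  refine-all-≤ : ∀ as s → proj₁ (refine-all as s) ≤ proj₁ s
  refine-all-≤ []       s = refl
  refine-all-≤ (a ∷ as) s = trans (refine-≤ a _) (refine-all-≤ as s)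

  refine-all-decides : ∀ {a as} → a ∈ as → ∀ s → Decides (proj₁ (refine-all as s)) a
  refine-all-decides (here ≡.refl) s = refine-decides _ _
  refine-all-decides (there a∈as)  s =
    Sum.map (trans (refine-≤ _ _)) (trans (∧-mono (refine-≤ _ _) refl))
      (refine-all-decides a∈as s)

  stage : ℕ → Stage
  stage zero    = c , c-compl , c≰𝟘
  stage (suc k) = refine-all (level k) (stage k)

  β : ℕ → ∣ A ∣
  β k = proj₁ (stage k)

  β-antitone : ∀ {j k} → j ≤′ k → β k ≤ β j
  β-antitone (≤′-reflexive ≡.refl) = refl
  β-antitone (≤′-step {k} j≤k)     = trans (refine-all-≤ (level k) (stage k)) (β-antitone j≤k)

  β-decides : ∀ a → ∃ λ k → Decides (β k) a
  β-decides a with exhaustive a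
  ... | k , a∈ = suc k , refine-all-decides a∈ (stage k)

  collapse : Rel ∣ A ∣ 0ℓ
  collapse x y = ∃ λ k → x ≡ β k × y ≡ 𝟙

  quotient : Algebra
  quotient = A /Cg collapse

  quotient∈Mod : Mod E quotient
  quotient∈Mod = /Cg-∈Mod A collapse A∈E

  Agree : ℕ → Rel ∣ A ∣ 0ℓ
  Agree k x y = β k ∧ x ≤ y × β k ∧ y ≤ x

  Agree-mono : ∀ {j k x y} → j ≤ᴺ k → Agree j x y → Agree k x y
  Agree-mono j≤k (p , q) =
    trans (∧-mono (β-antitone (≤⇒≤′ j≤k)) refl) p ,
    trans (∧-mono (β-antitone (≤⇒≤′ j≤k)) refl) q

  -- Agreement below some stage is already a congruence: `Agree-mono` merges two stages at the
  -- larger index, and `relative-cong` handles the operations.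
  collapse-sound : ∀ {x y} → Cg A collapse x y → ∃ λ k → Agree k x y
  collapse-sound (base (k , ≡.refl , ≡.refl)) = k , maximum _ , x∧y≤x _ _
  collapse-sound (≈⇒Cg x≈y) = 0 ,
    trans (x∧y≤y _ _) (reflexive x≈y) , trans (x∧y≤y _ _) (reflexive (Eq.sym x≈y))
  collapse-sound (Cg-sym p) with collapse-sound p
  ... | k , x≤y , y≤x = k , y≤x , x≤y
  collapse-sound (Cg-trans p q) with collapse-sound p | collapse-sound q
  ... | j , p′ | k , q′ with Agree-mono (m≤m⊔n j k) p′ | Agree-mono (m≤n⊔m j k) q′
  ... | x≤y , y≤x | y≤z , z≤y = j ⊔ k ,
    trans (∧-greatest (x∧y≤x _ _) x≤y) y≤z , trans (∧-greatest (x∧y≤x _ _) z≤y) y≤x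
  collapse-sound (Cg-cong o p q) with collapse-sound p | collapse-sound q
  ... | j , p′ | k , q′ with Agree-mono (m≤m⊔n j k) p′ | Agree-mono (m≤n⊔m j k) q′
  ... | x≤y , y≤x | u≤v , v≤u = j ⊔ k ,
    relative-cong (dhv A A∈E) (proj₁ (proj₂ (stage (j ⊔ k)))) o x≤y y≤x u≤v v≤u ,
    relative-cong (dhv A A∈E) (proj₁ (proj₂ (stage (j ⊔ k)))) o y≤x x≤y v≤u u≤v

  private
    module Q = DoubleHeyting (dhv quotient quotient∈Mod)

  box^-quotient : ∀ k a → box^ quotient k a ≡ box^ A k a
  box^-quotient zero    a = ≡.refl
  box^-quotient (suc k) a = ≡.cong (box A) (box^-quotient k a)

  𝟙≤β : ∀ k → 𝟙 Q.≤ β k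
  𝟙≤β k = Q.reflexive (Cg-sym (base (k , ≡.refl , ≡.refl)))

  -- The stage deciding `iff A a b` becomes top in the quotient, so the iterate `δ` becomes top or
  -- bottom. Top would identify `a` and `b`, since `δ` is below `iff A a b`; at bottom the switch
  -- returns `a`.
  quotient-discriminator-≉ : ∀ a b d → Nullary.¬ (a Q.≈ b) → discriminator quotient n a b d Q.≈ a
  quotient-discriminator-≉ a b d a≉b
    rewrite box^-quotient n (iff A a b) with β-decides (iff A a b)
  ... | k , inj₁ β≤δ   = contradiction (iff-elim (dhv quotient quotient∈Mod)
    (Q.trans (𝟙≤β k) (≈⇒Cg (trans β≤δ (box^-deflationary n _))))) a≉b
  ... | k , inj₂ β∧δ≤𝟘 = switch-𝟘 (dhv quotient quotient∈Mod)
    (Q.trans (Q.∧-greatest (Q.trans (Q.maximum _) (𝟙≤β k)) Q.refl) (≈⇒Cg β∧δ≤𝟘))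

  -- If `x` and `y` agreed below a stage, that stage would be a complemented element below
  -- `iff A x y`, hence below its iterate, but also below `c` and so below the negation of the
  -- iterate; yet no stage is `𝟘`.
  quotient-separates : ∀ {x y} → c ≤ ¬ box^ A n (iff A x y) → Nullary.¬ (x Q.≈ y)
  quotient-separates c≤¬δ x≈y with collapse-sound x≈y
  ... | k , x≤y , y≤x = proj₂ (proj₂ (stage k)) (trans (∧-greatest
    (trans (β-antitone (≤⇒≤′ (z≤n {k}))) c≤¬δ)
    (complemented⇒≤box^ (proj₁ (proj₂ (stage k))) (iff-intro (dhv A A∈E) x≤y y≤x) n)) (¬x∧x _))

-- Enumeration of terms and generation of the variety.

binops : List BinOp
binops = meet ∷ join ∷ imp ∷ sub ∷ []

∈-binops : ∀ o → o ∈ binops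
∈-binops meet = here ≡.refl
∈-binops join = there (here ≡.refl)
∈-binops imp  = there (there (here ≡.refl))
∈-binops sub  = there (there (there (here ≡.refl)))

applications : List (Term ℕ) → BinOp → List (Term ℕ)
applications ts o = cartesianProductWith (op o) ts ts

-- Increasing finite stages, with `var n` placed in stage `suc n`; they serve as the levels along
-- which the ultrafilter is built.
terms : ℕ → List (Term ℕ)
terms zero    = []
terms (suc n) = var n ∷ ⊥ ∷ ⊤ ∷ terms n ++ concatMap (applications (terms n)) binops

terms-mono : ∀ {m n} → m ≤′ n → terms m ⊆ˡ terms n
terms-mono (≤′-reflexive ≡.refl) t∈ = t∈
terms-mono (≤′-step m≤n)         t∈ = there (there (there (∈-++⁺ˡ (terms-mono m≤n t∈))))

terms-exhaustive : ∀ t → ∃ λ n → t ∈ terms n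
terms-exhaustive (var i)    = suc i , here ≡.refl
terms-exhaustive ⊥          = 1 , there (here ≡.refl)
terms-exhaustive ⊤          = 1 , there (there (here ≡.refl))
terms-exhaustive (op o s t) with terms-exhaustive s | terms-exhaustive t
... | j , s∈ | k , t∈ = suc (j ⊔ k) , there (there (there
  (∈-++⁺ʳ (terms (j ⊔ k)) (∈-concatMap⁺ (applications (terms (j ⊔ k)))
  (lose (∈-binops o) (∈-cartesianProductWith⁺ (op o)
    (terms-mono (≤⇒≤′ (m≤m⊔n j k)) s∈) (terms-mono (≤⇒≤′ (m≤n⊔m j k)) t∈)))))))

stable⇒discriminator-variety :
  (em : ∀ {ℓ : Level} → ExcludedMiddle ℓ) (E : Equations) (dhv : IsDoubleHeytingVariety E) (n : ℕ) →
  (∀ B → Mod E B → ∀ a → Algebra._≤_ B (box^ B n a) (box^ B (suc n) a)) →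
  IsDiscriminatorVariety E
stable⇒discriminator-variety em E dhv n stable = K , d , proj₂ , proj₁ , least
  where
  d : Term (Fin 3)
  d = discriminator (TermAlgebra _) n (var zero) (var (suc zero)) (var (suc (suc zero)))

  K : Pred Algebra 0ℓ
  K A = Mod E A × IsDiscriminatorTerm d A

  least : ∀ E′ → (∀ {A} → K A → Mod E′ A) → ∀ {A} → Mod E A → Mod E′ A
  least E′ K⊆E′ {A} A∈E s t s≈t∈E′ ρ with em {P = Algebra._≈_ A (eval A ρ s) (eval A ρ t)}
  ... | yes s≈t = s≈t
  ... | no  s≉t = contradiction
    (≡.subst₂ Q._≈_ (eval-quotient s) (eval-quotient t) (K⊆E′ Q∈K s t s≈t∈E′ var))
    (quotient-separates refl)
    where
    ker : Rel (Term ℕ) 0ℓ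
    ker u v = Algebra._≈_ A (eval A ρ u) (eval A ρ v)

    -- A copy of the subalgebra of `A` generated by the values of `ρ`, but with terms as elements,
    -- so that `terms` exhausts it.
    B : Algebra
    B = Free E ℕ /Cg ker

    B∈E : Mod E B
    B∈E = presented-∈Mod ker

    open DoubleHeyting (dhv B B∈E)

    δ : ∣ B ∣
    δ = box^ B n (iff B s t)

    δ-compl : Complemented δ
    δ-compl = ≤box⇒complemented (stable B B∈E _)

    -- Otherwise `δ` is top, hence so is `iff B s t`, and `s` and `t` have equal values in `A`.
    ¬δ≰𝟘 : Nullary.¬ (¬ δ ≤ 𝟘)
    ¬δ≰𝟘 ¬δ≤𝟘 = s≉t (presented-sound A A∈E ρ (λ u≈v → u≈v) (iff-elim (dhv B B∈E)
      (trans δ-compl (trans (∨-least refl (trans ¬δ≤𝟘 (minimum _))) (box^-deflationary n _)))))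

    open Ultraquotient em dhv n stable B B∈E terms terms-exhaustive
      (¬ δ) (¬-complemented δ-compl) ¬δ≰𝟘

    module Q = Algebra quotient

    eval-quotient : ∀ u → eval quotient var u ≡ u
    eval-quotient u = ≡.trans (eval-/Cg B collapse var u)
      (≡.trans (eval-presented ker var u) (eval-var u))

    value : ∀ a b c → eval quotient (a ∷ᵛ b ∷ᵛ c ∷ᵛ []ᵛ) d ≡ discriminator quotient n a b c
    value a b c = eval-discriminator quotient (a ∷ᵛ b ∷ᵛ c ∷ᵛ []ᵛ) n
      (var zero) (var (suc zero)) (var (suc (suc zero)))

    Q∈K : K quotient
    Q∈K = quotient∈Mod
      , (λ a c → ≡.subst (Q._≈ c) (≡.sym (value a a c))
          (discriminator-≈ (dhv quotient quotient∈Mod) n a c))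
      , (λ a b c a≉b → ≡.subst (Q._≈ a) (≡.sym (value a b c))
          (quotient-discriminator-≉ a b c a≉b))

theorem5p6 : (em : ∀ {ℓ : Level} → ExcludedMiddle ℓ) →
    (E : Equations) (dhv : IsDoubleHeytingVariety E) →
    ClosedUnderCanonicalExtensions E dhv →
    Coherent E →
    IsDiscriminatorVariety E
theorem5p6 em E dhv cce coherent =
  let n , stable = Stabilization.box^-stabilizes em E dhv cce coherent
  in stable⇒discriminator-variety em E dhv n stable
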